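{- The first-order theory $WT_{Rel}$ is interpretable in the first-order theory $VW^+$ (both defined in the context).
   Context: Interpretable means (relatively) formally interpretable in the usual sense. Both theories include the usual axioms for identity. $WT_{Rel}$: Let $\mathcal{L}_T=\{0,(\cdot,\cdot),\sqsubseteq\}$ with $0$ a constant and $(\cdot,\cdot)$ a binary function symbol; its variable-free terms are $0,(0,0),(0,(0,0)),\dots$, and $\mathcal{S}[t]$ is the set of all subterms of the variable-free term $t$ (including $t$). The vocabulary of $WT_{Rel}$ has a constant $\underline{t}$ for each variable-free $\mathcal{L}_T$-term $t$, a ternary relation symbol $T$ and a binary relation symbol $\sqsubseteq$. Axioms: (1) $\neg\,\underline{s}=\underline{t}$ for distinct variable-free $\mathcal{L}_T$-terms $s,t$; (2) $\forall x(x\sqsubseteq\underline{t}\leftrightarrow\bigvee_{s\in\mathcal{S}[t]}x=\underline{s})$ for each variable-free $\mathcal{L}_T$-term $t$; (3) $T(\underline{s},\underline{t},\underline{(s,t)})$ for variable-free $\mathcal{L}_T$-terms $s,t$; (4) $\forall x,y\,\exists z\,T(x,y,z)$; (5) $\forall x,y,u,v\,(T(x,y,u)\ \&\ T(x,y,v)\to u=v)$. $VW^+$: $\Sigma^*$ is the set of finite words over $\{1,2\}$, including the empty word $e$; $^\frown$ is concatenation; $lh(s)$ is the length of $s$; $s^{ -1}$ its reversal; $2^m$ the string of $m$ consecutive 2's ($2^0=e$). Signature $\{\underline{e},S_1,S_2,f,\sqsubseteq,|{\le}|\}$ ($\underline{e}$ a constant, $S_1,S_2,f$ unary functions, $\sqsubseteq,|{\le}|$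 binary relations). The canonical term of $e$ is $\underline{e}$, and $\underline{w^\frown d}$ is $S_d(\underline{w})$ for $d\in\{1,2\}$. Axioms: (VW1) $\neg\,\underline{s}=\underline{t}$ for distinct $s,t\in\Sigma^*$; (VW2) $S_d(\underline{t})=\underline{t^\frown d}$ for $t\in\Sigma^*$, $d=1,2$; (VW3) $\underline{e}\sqsubseteq\underline{t}$ for $t\in\Sigma^*$; (VW4) $\forall x(x\sqsubseteq\underline{e}\to x=\underline{e})$; (VW5) $\forall x(x\sqsubseteq S_d(\underline{t})\leftrightarrow x\sqsubseteq\underline{t}\vee x=S_d(\underline{t}))$ for $t\in\Sigma^*$, $d=1,2$; (VW6) $\forall x(x\,|{\le}|\,\underline{2^m}\leftrightarrow\bigvee_{lh(s)\le m}x=\underline{s})$ for $m\ge0$; (VW7) $\exists y\,(y\,|{\le}|\,\underline{t})\to\forall x(x\sqsubseteq\underline{t}\ \&\ x\ne\underline{e}\to\underline{2}\sqsubseteq f(x))$ for $t\in\Sigma^*$; (VW8) $f(\underline{t})=\underline{t^{ -1}}$ for $t\in\Sigma^*$; (VW9) $\forall x,y(f(x)=f(y)\to x=y)$; (VW10) $\forall x,y(x\sqsubseteq y\ \&\ y\sqsubseteq x\to x=y)$. -}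

module Defs where

open import Data.Nat using (ℕ; zero; suc; _+_)
open import Data.Fin using (Fin; zero; suc; _↑ˡ_; _↑ʳ_)
open import Data.Fin.Patterns using (0F; 1F; 2F; 3F)
open import Data.Vec using (Vec; []; _∷_)
open import Data.List using (List; []; _∷_; _++_; _∷ʳ_; map; foldl; foldr; allFin; replicate; reverse; concatMap)
open import Data.List.Membership.Propositional using (_∈_)
open import Data.Product using (Σ)
open import Function using (_∘_)
open import Relation.Binary.PropositionalEquality using (_≢_)

------------------------------------------------------------------------
-- Classical first-order logic with identity

record Signature : Set₁ where
  field
    Fun : Set
    arF : Fun → ℕ
    Rel : Set
    arR : Rel → ℕ

open Signature public

-- Well-scoped de Bruijn syntax: Term L n and Formula L n have their free
-- variables among var 0, …, var (n-1); a quantifier binds var 0.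
data Term (L : Signature) (n : ℕ) : Set where
  var : Fin n → Term L n
  fun : (f : Fun L) → Vec (Term L n) (arF L f) → Term L n

infix  9 _≐_
infixr 7 _∧_
infixr 6 _∨_
infixr 5 _⇒_

data Formula (L : Signature) : ℕ → Set where
  rel     : ∀ {n} (R : Rel L) → Vec (Term L n) (arR L R) → Formula L n
  _≐_     : ∀ {n} → Term L n → Term L n → Formula L n
  ⊥       : ∀ {n} → Formula L n
  _⇒_     : ∀ {n} → Formula L n → Formula L n → Formula L n
  _∧_ _∨_ : ∀ {n} → Formula L n → Formula L n → Formula L n
  ∀′ ∃′   : ∀ {n} → Formula L (suc n) → Formula L n

Sentence : Signature → Set
Sentence L = Formula L 0

Theory : Signature → Set₁
Theory L = Sentence L → Set

module _ {L : Signature} where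

  infix 8 ¬_
  infix 5 _⇔_

  ⊤ : ∀ {n} → Formula L n
  ⊤ = ⊥ ⇒ ⊥

  ¬_ : ∀ {n} → Formula L n → Formula L n
  ¬ φ = φ ⇒ ⊥

  _⇔_ : ∀ {n} → Formula L n → Formula L n → Formula L n
  φ ⇔ ψ = (φ ⇒ ψ) ∧ (ψ ⇒ φ)

  ⋀ ⋁ : ∀ {n} → List (Formula L n) → Formula L n
  ⋀ = foldr _∧_ ⊤
  ⋁ = foldr _∨_ ⊥

  lift : ∀ {m n} → (Fin m → Fin n) → Fin (suc m) → Fin (suc n)
  lift ρ zero    = zero
  lift ρ (suc i) = suc (ρ i)

  renT  : ∀ {m n} → (Fin m → Fin n) → Term L m → Term L n
  renTs : ∀ {m n k} → (Fin m → Fin n) → Vec (Term L m) k → Vec (Term L n) k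
  renT ρ (var i)    = var (ρ i)
  renT ρ (fun f ts) = fun f (renTs ρ ts)
  renTs ρ []        = []
  renTs ρ (t ∷ ts)  = renT ρ t ∷ renTs ρ ts

  ren : ∀ {m n} → (Fin m → Fin n) → Formula L m → Formula L n
  ren ρ (rel R ts) = rel R (renTs ρ ts)
  ren ρ (s ≐ t)    = renT ρ s ≐ renT ρ t
  ren ρ ⊥          = ⊥
  ren ρ (φ ⇒ ψ)    = ren ρ φ ⇒ ren ρ ψ
  ren ρ (φ ∧ ψ)    = ren ρ φ ∧ ren ρ ψ
  ren ρ (φ ∨ ψ)    = ren ρ φ ∨ ren ρ ψ
  ren ρ (∀′ φ)     = ∀′ (ren (lift ρ) φ)
  ren ρ (∃′ φ)     = ∃′ (ren (lift ρ) φ)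

  wk : ∀ {n} → Formula L n → Formula L (suc n)
  wk = ren suc

  liftS : ∀ {m n} → (Fin m → Term L n) → Fin (suc m) → Term L (suc n)
  liftS σ zero    = var zero
  liftS σ (suc i) = renT suc (σ i)

  subT  : ∀ {m n} → (Fin m → Term L n) → Term L m → Term L n
  subTs : ∀ {m n k} → (Fin m → Term L n) → Vec (Term L m) k → Vec (Term L n) k
  subT σ (var i)    = σ i
  subT σ (fun f ts) = fun f (subTs σ ts)
  subTs σ []        = []
  subTs σ (t ∷ ts)  = subT σ t ∷ subTs σ ts

  sub : ∀ {m n} → (Fin m → Term L n) → Formula L m → Formula L n
  sub σ (rel R ts) = rel R (subTs σ ts)
  sub σ (s ≐ t)    = subT σ s ≐ subT σ t
  sub σ ⊥          = ⊥
  sub σ (φ ⇒ ψ)    = sub σ φ ⇒ sub σ ψ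
  sub σ (φ ∧ ψ)    = sub σ φ ∧ sub σ ψ
  sub σ (φ ∨ ψ)    = sub σ φ ∨ sub σ ψ
  sub σ (∀′ φ)     = ∀′ (sub (liftS σ) φ)
  sub σ (∃′ φ)     = ∃′ (sub (liftS σ) φ)

  inst : ∀ {n} → Term L n → Fin (suc n) → Term L n
  inst t zero    = t
  inst t (suc i) = var i

  _[_] : ∀ {n} → Formula L (suc n) → Term L n → Formula L n
  φ [ t ] = sub (inst t) φ

  ∃! : ∀ {n} → Formula L (suc n) → Formula L n
  ∃! φ = ∃′ (φ ∧ ∀′ (ren (lift suc) φ ⇒ var 0F ≐ var 1F))

  ∀-closure : ∀ {n} → Formula L n → Sentence L
  ∀-closure {zero}  φ = φ
  ∀-closure {suc n} φ = ∀-closure (∀′ φ)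

  ∃^ : ∀ k {n} → Formula L (k + n) → Formula L n
  ∃^ zero    φ = φ
  ∃^ (suc k) φ = ∃^ k (∃′ φ)

-- T ⨾ Γ ⊢ φ is natural deduction from the axioms of T and hypotheses Γ.  As
-- scopes are explicit, that domains are inhabited needs a rule of its own.
infix 3 _⨾_⊢_

data _⨾_⊢_ {L : Signature} (T : Theory L) {n : ℕ} (Γ : List (Formula L n)) :
           Formula L n → Set where
  axiom     : ∀ {φ} → T φ → T ⨾ Γ ⊢ ren (λ ()) φ
  hyp       : ∀ {φ} → φ ∈ Γ → T ⨾ Γ ⊢ φ
  raa       : ∀ {φ} → T ⨾ ¬ φ ∷ Γ ⊢ ⊥ → T ⨾ Γ ⊢ φ
  ⇒-intro   : ∀ {φ ψ} → T ⨾ φ ∷ Γ ⊢ ψ → T ⨾ Γ ⊢ φ ⇒ ψ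
  ⇒-elim    : ∀ {φ ψ} → T ⨾ Γ ⊢ φ ⇒ ψ → T ⨾ Γ ⊢ φ → T ⨾ Γ ⊢ ψ
  ∧-intro   : ∀ {φ ψ} → T ⨾ Γ ⊢ φ → T ⨾ Γ ⊢ ψ → T ⨾ Γ ⊢ φ ∧ ψ
  ∧-elim₁   : ∀ {φ ψ} → T ⨾ Γ ⊢ φ ∧ ψ → T ⨾ Γ ⊢ φ
  ∧-elim₂   : ∀ {φ ψ} → T ⨾ Γ ⊢ φ ∧ ψ → T ⨾ Γ ⊢ ψ
  ∨-intro₁  : ∀ {φ ψ} → T ⨾ Γ ⊢ φ → T ⨾ Γ ⊢ φ ∨ ψ
  ∨-intro₂  : ∀ {φ ψ} → T ⨾ Γ ⊢ ψ → T ⨾ Γ ⊢ φ ∨ ψ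
  ∨-elim    : ∀ {φ ψ χ} → T ⨾ Γ ⊢ φ ∨ ψ → T ⨾ φ ∷ Γ ⊢ χ → T ⨾ ψ ∷ Γ ⊢ χ → T ⨾ Γ ⊢ χ
  ∀-intro   : ∀ {φ} → T ⨾ map wk Γ ⊢ φ → T ⨾ Γ ⊢ ∀′ φ
  ∀-elim    : ∀ {φ} → T ⨾ Γ ⊢ ∀′ φ → (t : Term L n) → T ⨾ Γ ⊢ φ [ t ]
  ∃-intro   : ∀ {φ} (t : Term L n) → T ⨾ Γ ⊢ φ [ t ] → T ⨾ Γ ⊢ ∃′ φ
  ∃-elim    : ∀ {φ ψ} → T ⨾ Γ ⊢ ∃′ φ → T ⨾ φ ∷ map wk Γ ⊢ wk ψ → T ⨾ Γ ⊢ ψ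
  ≐-refl    : ∀ t → T ⨾ Γ ⊢ t ≐ t
  ≐-subst   : ∀ φ {s t} → T ⨾ Γ ⊢ s ≐ t → T ⨾ Γ ⊢ φ [ s ] → T ⨾ Γ ⊢ φ [ t ]
  inhabited : T ⨾ Γ ⊢ ∃′ (var 0F ≐ var 0F)

infix 3 _⊢_

_⊢_ : {L : Signature} → Theory L → Sentence L → Set
T ⊢ φ = T ⨾ [] ⊢ φ

------------------------------------------------------------------------
-- Relative interpretations: one-dimensional, without parameters, identity
-- being interpreted as identity.

-- In funτ f, var 0 is the value and var 1, …, var k are the arguments of f;
-- in relτ R, var 0, …, var (k-1) are the arguments of R.
record Translation (L M : Signature) : Set where
  field
    dom  : Formula M 1
    funτ : (f : Fun L) → Formula M (suc (arF L f))
    relτ : (R : Rel L) → Formula M (arR L R)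

  inDom : ∀ {n} → Fin n → Formula M n
  inDom x = ren (λ _ → x) dom

  -- value t ρ y says that y is the value of (the translation of) t, where ρ
  -- places the variables of t in the current scope; values does this for a
  -- vector of terms, requiring also that the values lie in the domain.
  value  : ∀ {n m} → Term L n → (Fin n → Fin m) → Fin m → Formula M m
  values : ∀ {n m k} → Vec (Term L n) k → (Fin n → Fin m) → (Fin k → Fin m) → Formula M m
  value         (var x)    ρ y = var y ≐ var (ρ x)
  value {m = m} (fun f ts) ρ y =
    ∃^ k (values ts ((k ↑ʳ_) ∘ ρ) (_↑ˡ m) ∧ ren graph (funτ f))
    where
    k : ℕ
    k = arF L f
    graph : Fin (suc k) → Fin (k + m)
    graph zero    = k ↑ʳ y
    graph (suc i) = i ↑ˡ m
  values []       ρ ys = ⊤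
  values (t ∷ ts) ρ ys = (inDom (ys zero) ∧ value t ρ (ys zero)) ∧ values ts ρ (ys ∘ suc)

  -- The formula θ (x₀, …, xₖ₋₁) at the values of the terms ts.
  atValues : ∀ {n k} → Vec (Term L n) k → Formula M k → Formula M n
  atValues {n} {k} ts θ = ∃^ k (values ts (k ↑ʳ_) (_↑ˡ n) ∧ ren (_↑ˡ n) θ)

  translate : ∀ {n} → Formula L n → Formula M n
  translate (rel R ts) = atValues ts (relτ R)
  translate (s ≐ t)    = atValues (s ∷ t ∷ []) (var 0F ≐ var 1F)
  translate ⊥          = ⊥
  translate (φ ⇒ ψ)    = translate φ ⇒ translate ψ
  translate (φ ∧ ψ)    = translate φ ∧ translate ψ
  translate (φ ∨ ψ)    = translate φ ∨ translate ψ
  translate (∀′ φ)     = ∀′ (inDom 0F ⇒ translate φ)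
  translate (∃′ φ)     = ∃′ (inDom 0F ∧ translate φ)

  functional : Fun L → Sentence M
  functional f = ∀-closure (⋀ (map inDom (allFin (arF L f))) ⇒ ∃! (inDom 0F ∧ funτ f))

record IsInterpretation {L M : Signature} (S : Theory L) (T : Theory M)
                        (τ : Translation L M) : Set where
  open Translation τ
  field
    dom-inhabited : T ⊢ ∃′ dom
    fun-total     : ∀ f → T ⊢ functional f
    axioms        : ∀ {φ} → S φ → T ⊢ translate φ

infix 2 _IsInterpretableIn_

_IsInterpretableIn_ : {L M : Signature} → Theory L → Theory M → Set
_IsInterpretableIn_ {L} {M} S T = Σ (Translation L M) (IsInterpretation S T)

------------------------------------------------------------------------
-- The theory WT_Rel

-- The variable-free terms over 0 and (·,·).
data Tree : Set where
  𝟎     : Tree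
  ⟨_,_⟩ : Tree → Tree → Tree

-- The set 𝒮[t], listed with possible repetitions.
subterms : Tree → List Tree
subterms 𝟎         = 𝟎 ∷ []
subterms ⟨ s , t ⟩ = ⟨ s , t ⟩ ∷ subterms s ++ subterms t

data WTRelation : Set where
  T-rel ⊑-rel : WTRelation

WTSig : Signature
WTSig = record
  { Fun = Tree
  ; arF = λ _ → 0
  ; Rel = WTRelation
  ; arR = λ { T-rel → 3 ; ⊑-rel → 2 }
  }

module WTSyntax where

  infix 9 _⊑_

  _̲ : ∀ {n} → Tree → Term WTSig n
  t ̲ = fun t []

  T : ∀ {n} → Term WTSig n → Term WTSig n → Term WTSig n → Formula WTSig n
  T r s t = rel T-rel (r ∷ s ∷ t ∷ [])

  _⊑_ : ∀ {n} → Term WTSig n → Term WTSig n → Formula WTSig n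
  s ⊑ t = rel ⊑-rel (s ∷ t ∷ [])

module _ where
  open WTSyntax

  data WTRel : Theory WTSig where
    WT1 : ∀ {s t} → s ≢ t → WTRel (¬ (s ̲ ≐ t ̲))
    WT2 : ∀ t → WTRel (∀′ (var 0F ⊑ t ̲ ⇔ ⋁ (map (λ s → var 0F ≐ s ̲) (subterms t))))
    WT3 : ∀ s t → WTRel (T (s ̲) (t ̲) (⟨ s , t ⟩ ̲))
    WT4 : WTRel (∀′ (∀′ (∃′ (T (var 2F) (var 1F) (var 0F)))))
    WT5 : WTRel (∀′ (∀′ (∀′ (∀′
            (T (var 3F) (var 2F) (var 1F) ∧ T (var 3F) (var 2F) (var 0F) ⇒ var 1F ≐ var 0F)))))

------------------------------------------------------------------------
-- The theory VW⁺

data Letter : Set where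
  𝟏 𝟐 : Letter

Word : Set
Word = List Letter

wordsOfLength : ℕ → List Word
wordsOfLength zero    = [] ∷ []
wordsOfLength (suc k) = concatMap (λ w → (𝟏 ∷ w) ∷ (𝟐 ∷ w) ∷ []) (wordsOfLength k)

wordsUpTo : ℕ → List Word
wordsUpTo zero    = wordsOfLength zero
wordsUpTo (suc m) = wordsUpTo m ++ wordsOfLength (suc m)

data VWFunction : Set where
  e-fun f-fun : VWFunction
  S-fun       : Letter → VWFunction

data VWRelation : Set where
  ⊑-rel ∣≤∣-rel : VWRelation

VWSig : Signature
VWSig = record
  { Fun = VWFunction
  ; arF = λ { e-fun → 0 ; f-fun → 1 ; (S-fun _) → 1 }
  ; Rel = VWRelation
  ; arR = λ { ⊑-rel → 2 ; ∣≤∣-rel → 2 }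
  }

module VWSyntax where

  infix 9 _⊑_ _∣≤∣_

  e : ∀ {n} → Term VWSig n
  e = fun e-fun []

  S : ∀ {n} → Letter → Term VWSig n → Term VWSig n
  S d t = fun (S-fun d) (t ∷ [])

  f : ∀ {n} → Term VWSig n → Term VWSig n
  f t = fun f-fun (t ∷ [])

  _⊑_ _∣≤∣_ : ∀ {n} → Term VWSig n → Term VWSig n → Formula VWSig n
  s ⊑ t   = rel ⊑-rel (s ∷ t ∷ [])
  s ∣≤∣ t = rel ∣≤∣-rel (s ∷ t ∷ [])

  -- Letters are appended on the right: (w ∷ʳ d) ̲ is S d (w ̲).
  _̲ : ∀ {n} → Word → Term VWSig n
  w ̲ = foldl (λ t d → S d t) e w

module _ where
  open VWSyntax

  data VW⁺ : Theory VWSig where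
    VW1  : ∀ {s t} → s ≢ t → VW⁺ (¬ (s ̲ ≐ t ̲))
    VW2  : ∀ t d → VW⁺ (S d (t ̲) ≐ (t ∷ʳ d) ̲)
    VW3  : ∀ t → VW⁺ (e ⊑ t ̲)
    VW4  : VW⁺ (∀′ (var 0F ⊑ e ⇒ var 0F ≐ e))
    VW5  : ∀ t d → VW⁺ (∀′ (var 0F ⊑ S d (t ̲) ⇔ (var 0F ⊑ t ̲ ∨ var 0F ≐ S d (t ̲))))
    VW6  : ∀ m → VW⁺ (∀′ (var 0F ∣≤∣ replicate m 𝟐 ̲ ⇔ ⋁ (map (λ s → var 0F ≐ s ̲) (wordsUpTo m))))
    VW7  : ∀ t → VW⁺ (∃′ (var 0F ∣≤∣ t ̲) ⇒
             ∀′ (var 0F ⊑ t ̲ ∧ ¬ (var 0F ≐ e) ⇒ (𝟐 ∷ []) ̲ ⊑ f (var 0F)))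
    VW8  : ∀ t → VW⁺ (f (t ̲) ≐ reverse t ̲)
    VW9  : VW⁺ (∀′ (∀′ (f (var 1F) ≐ f (var 0F) ⇒ var 1F ≐ var 0F)))
    VW10 : VW⁺ (∀′ (∀′ (var 1F ⊑ var 0F ∧ var 0F ⊑ var 1F ⇒ var 1F ≐ var 0F)))

{-# OPTIONS --safe #-}

-- A tree is coded by a word: 𝟎 by 1, and ⟨ s , t ⟩ by 2^k 1 c with c = x 1 y,
-- where x and y code s and t and k is the length of c.  Since every coded subtree
-- announces its own length, x codes a subterm of the tree coded by y exactly when
-- x is a subword of y of the form 2^k 1 c with k = lh(c) which is initial or
-- follows a 1.  Concatenation is definable on words up to a length bound: a word
-- with a single 1 adds lengths.  So both the graph of pairing and the subterm
-- relation are given by formulas whose quantifiers are bounded by x |≤| w, and VW⁺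
-- decides such formulas at canonical terms.  To find a bound w without assuming
-- that it is a numeral, take one that is least in the sense of ⊑ among the w closed
-- under u ↦ S₂ u below w; such a w is a standard 2^m as soon as some standard 2^m
-- works.  Finally pairing is made total by the value e where it is undefined or
-- ambiguous.  Words are read from right to left, that is, the code of a tree is the
-- reversal of the word described here.

module Submission where

open import Defs
open import Data.Empty using (⊥-elim)
open import Data.Fin using (Fin; zero; suc; _↑ˡ_; _↑ʳ_)
open import Data.Fin.Patterns using (0F; 1F; 2F; 3F)
open import Data.List using (List; []; _∷_; _++_; _∷ʳ_; map; foldr; reverse; replicate; length)
open import Data.List.Membership.Propositional using (_∈_; find)
open import Data.List.Membership.Propositional.Properties
  using (∈-map⁺; ∈-map⁻; ∈-concatMap⁺; ∈-concatMap⁻; ∈-++⁺ˡ; ∈-++⁺ʳ; ∈-++⁻)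
open import Data.List.Properties
  using (≡-dec; ++-assoc; ++-cancelˡ; ++-identityʳ; length-++; length-replicate; length-reverse;
         reverse-++; reverse-foldl; reverse-foldr; reverse-injective; reverse-involutive;
         unfold-reverse; ∷-injective; ∷-injectiveʳ)
open import Data.List.Relation.Binary.Subset.Propositional using (_⊆_)
open import Data.List.Relation.Binary.Subset.Propositional.Properties using (map⁺; ∷⁺ʳ)
open import Data.List.Relation.Unary.Any as Any using (here; there)
open import Data.Nat using (ℕ; zero; suc; _+_; _≤_; _<_; z≤n; s≤s; _≤?_)
open import Data.Nat.Properties
  using (≤-refl; ≤-reflexive; ≤-trans; <-irrefl; m≤n⇒m≤1+n; m≤n⇒m<n∨m≡n; m≤m+n; m≤n+m; n≤1+n;
         suc-injective; +-cancelʳ-≡)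
open import Data.Product using (∃; _×_; _,_; proj₁; proj₂)
open import Data.Sum using (_⊎_; inj₁; inj₂; [_,_]′)
open import Data.Vec using (Vec; []; _∷_; lookup)
open import Data.Vec.Functional using () renaming ([] to ε; _∷_ to infixr 5 _▹_)
open import Function using (_∘_; id)
open import Relation.Binary.Definitions using (DecidableEquality)
open import Relation.Binary.PropositionalEquality
  using (_≡_; _≢_; refl; sym; trans; cong; cong₂; subst; module ≡-Reasoning)
open import Relation.Nullary using (Dec; yes; no; contradiction) renaming (¬_ to Not)
open import Relation.Nullary.Decidable using (map′; _×-dec_; ¬?; decidable-stable)

-- Substitution

module _ {L : Signature} where

  private variable
    l m n k : ℕ

  subT-cong : {σ τ : Fin m → Term L n} → (∀ i → σ i ≡ τ i) → ∀ t → subT σ t ≡ subT τ t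
  subTs-cong : {σ τ : Fin m → Term L n} → (∀ i → σ i ≡ τ i) →
               (ts : Vec (Term L m) k) → subTs σ ts ≡ subTs τ ts
  subT-cong eq (var i)    = eq i
  subT-cong eq (fun f ts) = cong (fun f) (subTs-cong eq ts)
  subTs-cong eq []        = refl
  subTs-cong eq (t ∷ ts)  = cong₂ _∷_ (subT-cong eq t) (subTs-cong eq ts)

  renT≡subT : (ρ : Fin m → Fin n) → ∀ t → renT ρ t ≡ subT {L} (var ∘ ρ) t
  renTs≡subTs : (ρ : Fin m → Fin n) → (ts : Vec (Term L m) k) → renTs ρ ts ≡ subTs (var ∘ ρ) ts
  renT≡subT ρ (var i)     = refl
  renT≡subT ρ (fun f ts)  = cong (fun f) (renTs≡subTs ρ ts)
  renTs≡subTs ρ []        = refl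
  renTs≡subTs ρ (t ∷ ts)  = cong₂ _∷_ (renT≡subT ρ t) (renTs≡subTs ρ ts)

  subT-subT : (σ : Fin m → Term L n) (τ : Fin l → Term L m) → ∀ t →
              subT σ (subT τ t) ≡ subT (subT σ ∘ τ) t
  subTs-subTs : (σ : Fin m → Term L n) (τ : Fin l → Term L m) → (ts : Vec (Term L l) k) →
                subTs σ (subTs τ ts) ≡ subTs (subT σ ∘ τ) ts
  subT-subT σ τ (var i)     = refl
  subT-subT σ τ (fun f ts)  = cong (fun f) (subTs-subTs σ τ ts)
  subTs-subTs σ τ []        = refl
  subTs-subTs σ τ (t ∷ ts)  = cong₂ _∷_ (subT-subT σ τ t) (subTs-subTs σ τ ts)

  subT-var : (t : Term L n) → subT var t ≡ t
  subTs-var : (ts : Vec (Term L n) k) → subTs var ts ≡ ts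
  subT-var (var i)    = refl
  subT-var (fun f ts) = cong (fun f) (subTs-var ts)
  subTs-var []        = refl
  subTs-var (t ∷ ts)  = cong₂ _∷_ (subT-var t) (subTs-var ts)

  subT-renT : (σ : Fin m → Term L n) (ρ : Fin l → Fin m) → ∀ t → subT σ (renT ρ t) ≡ subT (σ ∘ ρ) t
  subT-renT σ ρ t = trans (cong (subT σ) (renT≡subT ρ t)) (subT-subT σ (var ∘ ρ) t)

  renT-subT : (ρ : Fin m → Fin n) (σ : Fin l → Term L m) → ∀ t → renT ρ (subT σ t) ≡ subT (renT ρ ∘ σ) t
  renT-subT ρ σ t = trans (renT≡subT ρ (subT σ t))
    (trans (subT-subT (var ∘ ρ) σ t) (subT-cong (λ i → sym (renT≡subT ρ (σ i))) t))

  inst-renT-suc : (s t : Term L n) → subT (inst s) (renT suc t) ≡ t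
  inst-renT-suc s t = trans (subT-renT (inst s) suc t) (subT-var t)

  liftS-cong : {σ τ : Fin m → Term L n} → (∀ i → σ i ≡ τ i) → ∀ i → liftS σ i ≡ liftS τ i
  liftS-cong eq zero    = refl
  liftS-cong eq (suc i) = cong (renT suc) (eq i)

  liftS-liftS : (σ : Fin m → Term L n) (τ : Fin l → Term L m) →
                ∀ i → subT (liftS σ) (liftS τ i) ≡ liftS (subT σ ∘ τ) i
  liftS-liftS σ τ zero    = refl
  liftS-liftS σ τ (suc i) = trans (subT-renT (liftS σ) suc (τ i)) (sym (renT-subT suc σ (τ i)))

  sub-cong : {σ τ : Fin m → Term L n} → (∀ i → σ i ≡ τ i) → ∀ φ → sub σ φ ≡ sub τ φ
  sub-cong eq (rel R ts) = cong (rel R) (subTs-cong eq ts)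
  sub-cong eq (s ≐ t)    = cong₂ _≐_ (subT-cong eq s) (subT-cong eq t)
  sub-cong eq ⊥          = refl
  sub-cong eq (φ ⇒ ψ)    = cong₂ _⇒_ (sub-cong eq φ) (sub-cong eq ψ)
  sub-cong eq (φ ∧ ψ)    = cong₂ _∧_ (sub-cong eq φ) (sub-cong eq ψ)
  sub-cong eq (φ ∨ ψ)    = cong₂ _∨_ (sub-cong eq φ) (sub-cong eq ψ)
  sub-cong eq (∀′ φ)     = cong ∀′ (sub-cong (liftS-cong eq) φ)
  sub-cong eq (∃′ φ)     = cong ∃′ (sub-cong (liftS-cong eq) φ)

  sub-sub : (σ : Fin m → Term L n) (τ : Fin l → Term L m) → ∀ φ → sub σ (sub τ φ) ≡ sub (subT σ ∘ τ) φ
  sub-sub σ τ (rel R ts) = cong (rel R) (subTs-subTs σ τ ts)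
  sub-sub σ τ (s ≐ t)    = cong₂ _≐_ (subT-subT σ τ s) (subT-subT σ τ t)
  sub-sub σ τ ⊥          = refl
  sub-sub σ τ (φ ⇒ ψ)    = cong₂ _⇒_ (sub-sub σ τ φ) (sub-sub σ τ ψ)
  sub-sub σ τ (φ ∧ ψ)    = cong₂ _∧_ (sub-sub σ τ φ) (sub-sub σ τ ψ)
  sub-sub σ τ (φ ∨ ψ)    = cong₂ _∨_ (sub-sub σ τ φ) (sub-sub σ τ ψ)
  sub-sub σ τ (∀′ φ)     = cong ∀′ (trans (sub-sub (liftS σ) (liftS τ) φ) (sub-cong (liftS-liftS σ τ) φ))
  sub-sub σ τ (∃′ φ)     = cong ∃′ (trans (sub-sub (liftS σ) (liftS τ) φ) (sub-cong (liftS-liftS σ τ) φ))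

  liftS-var : (ρ : Fin m → Fin n) → ∀ i → var (lift {L} ρ i) ≡ liftS {L} (var ∘ ρ) i
  liftS-var ρ zero    = refl
  liftS-var ρ (suc i) = refl

  ren≡sub : (ρ : Fin m → Fin n) → ∀ φ → ren ρ φ ≡ sub {L} (var ∘ ρ) φ
  ren≡sub ρ (rel R ts) = cong (rel R) (renTs≡subTs ρ ts)
  ren≡sub ρ (s ≐ t)    = cong₂ _≐_ (renT≡subT ρ s) (renT≡subT ρ t)
  ren≡sub ρ ⊥          = refl
  ren≡sub ρ (φ ⇒ ψ)    = cong₂ _⇒_ (ren≡sub ρ φ) (ren≡sub ρ ψ)
  ren≡sub ρ (φ ∧ ψ)    = cong₂ _∧_ (ren≡sub ρ φ) (ren≡sub ρ ψ)
  ren≡sub ρ (φ ∨ ψ)    = cong₂ _∨_ (ren≡sub ρ φ) (ren≡sub ρ ψ)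
  ren≡sub ρ (∀′ φ)     = cong ∀′ (trans (ren≡sub (lift {L} ρ) φ) (sub-cong (liftS-var ρ) φ))
  ren≡sub ρ (∃′ φ)     = cong ∃′ (trans (ren≡sub (lift {L} ρ) φ) (sub-cong (liftS-var ρ) φ))

  sub-ren : (σ : Fin m → Term L n) (ρ : Fin l → Fin m) → ∀ φ → sub σ (ren ρ φ) ≡ sub (σ ∘ ρ) φ
  sub-ren σ ρ φ = trans (cong (sub σ) (ren≡sub ρ φ)) (sub-sub σ (var ∘ ρ) φ)

  ren-sub : (ρ : Fin m → Fin n) (σ : Fin l → Term L m) → ∀ φ → ren ρ (sub σ φ) ≡ sub (renT ρ ∘ σ) φ
  ren-sub ρ σ φ = trans (ren≡sub ρ (sub σ φ))
    (trans (sub-sub (var ∘ ρ) σ φ) (sub-cong (λ i → sym (renT≡subT ρ (σ i))) φ))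

  sub-var : (φ : Formula L n) → sub var φ ≡ φ
  sub-var (rel R ts) = cong (rel R) (subTs-var ts)
  sub-var (s ≐ t)    = cong₂ _≐_ (subT-var s) (subT-var t)
  sub-var ⊥          = refl
  sub-var (φ ⇒ ψ)    = cong₂ _⇒_ (sub-var φ) (sub-var ψ)
  sub-var (φ ∧ ψ)    = cong₂ _∧_ (sub-var φ) (sub-var ψ)
  sub-var (φ ∨ ψ)    = cong₂ _∨_ (sub-var φ) (sub-var ψ)
  sub-var (∀′ φ)     = cong ∀′ (trans (sub-cong (λ { zero → refl ; (suc i) → refl }) φ) (sub-var φ))
  sub-var (∃′ φ)     = cong ∃′ (trans (sub-cong (λ { zero → refl ; (suc i) → refl }) φ) (sub-var φ))

  sub-inst-liftS : (σ : Fin m → Term L n) (t : Term L n) → ∀ φ → sub (liftS σ) φ [ t ] ≡ sub (t ▹ σ) φ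
  sub-inst-liftS σ t φ = trans (sub-sub (inst t) (liftS σ) φ)
    (sub-cong (λ { zero → refl ; (suc i) → inst-renT-suc t (σ i) }) φ)

  -- The simultaneous instance of a block of `k` quantifiers, as in `∃^ k`; its recursion follows
  -- that of `k + n`, so the quantifiers can be removed one at a time.
  prepend : ∀ k → (Fin k → Term L m) → (Fin n → Term L m) → Fin (k + n) → Term L m
  prepend zero    σ δ = δ
  prepend (suc k) σ δ = σ zero ▹ prepend k (σ ∘ suc) δ

  prepend-↑ˡ : ∀ k (σ : Fin k → Term L m) (δ : Fin n → Term L m) i → prepend k σ δ (i ↑ˡ n) ≡ σ i
  prepend-↑ˡ (suc k) σ δ zero    = refl
  prepend-↑ˡ (suc k) σ δ (suc i) = prepend-↑ˡ k (σ ∘ suc) δ i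

  prepend-↑ʳ : ∀ k (σ : Fin k → Term L m) (δ : Fin n → Term L m) i → prepend k σ δ (k ↑ʳ i) ≡ δ i
  prepend-↑ʳ zero    σ δ i = refl
  prepend-↑ʳ (suc k) σ δ i = prepend-↑ʳ k (σ ∘ suc) δ i

  subT-prepend-↑ʳ : ∀ k (σ : Fin k → Term L n) t → subT (prepend k σ var) (renT (k ↑ʳ_) t) ≡ t
  subT-prepend-↑ʳ k σ t = trans (subT-renT (prepend k σ var) (k ↑ʳ_) t)
    (trans (subT-cong (prepend-↑ʳ k σ var) t) (subT-var t))

  sub-prepend-↑ˡ : ∀ k (σ : Fin k → Term L n) φ → sub (prepend k σ var) (ren (_↑ˡ n) φ) ≡ sub σ φ
  sub-prepend-↑ˡ k σ φ = trans (sub-ren (prepend k σ var) (_↑ˡ _) φ) (sub-cong (prepend-↑ˡ k σ var) φ)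

-- Natural deduction

module _ {L : Signature} {T : Theory L} where

  private variable
    m n : ℕ
    Γ Δ : List (Formula L n)
    φ ψ χ : Formula L n

  weaken : Γ ⊆ Δ → T ⨾ Γ ⊢ φ → T ⨾ Δ ⊢ φ
  weaken ι (axiom a)       = axiom a
  weaken ι (hyp h)         = hyp (ι h)
  weaken ι (raa d)         = raa (weaken (∷⁺ʳ _ ι) d)
  weaken ι (⇒-intro d)     = ⇒-intro (weaken (∷⁺ʳ _ ι) d)
  weaken ι (⇒-elim d e)    = ⇒-elim (weaken ι d) (weaken ι e)
  weaken ι (∧-intro d e)   = ∧-intro (weaken ι d) (weaken ι e)
  weaken ι (∧-elim₁ d)     = ∧-elim₁ (weaken ι d)
  weaken ι (∧-elim₂ d)     = ∧-elim₂ (weaken ι d)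
  weaken ι (∨-intro₁ d)    = ∨-intro₁ (weaken ι d)
  weaken ι (∨-intro₂ d)    = ∨-intro₂ (weaken ι d)
  weaken ι (∨-elim d e f)  = ∨-elim (weaken ι d) (weaken (∷⁺ʳ _ ι) e) (weaken (∷⁺ʳ _ ι) f)
  weaken ι (∀-intro d)     = ∀-intro (weaken (map⁺ wk ι) d)
  weaken ι (∀-elim d t)    = ∀-elim (weaken ι d) t
  weaken ι (∃-intro t d)   = ∃-intro t (weaken ι d)
  weaken ι (∃-elim d e)    = ∃-elim (weaken ι d) (weaken (∷⁺ʳ _ (map⁺ wk ι)) e)
  weaken ι (≐-refl t)      = ≐-refl t
  weaken ι (≐-subst φ d e) = ≐-subst φ (weaken ι d) (weaken ι e)
  weaken ι inhabited       = inhabited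

  weaken₁ : T ⨾ Γ ⊢ φ → T ⨾ ψ ∷ Γ ⊢ φ
  weaken₁ = weaken there

  hyp₀ : T ⨾ φ ∷ Γ ⊢ φ
  hyp₀ = hyp (here refl)

  hyp₁ : T ⨾ ψ ∷ φ ∷ Γ ⊢ φ
  hyp₁ = hyp (there (here refl))

  conv : φ ≡ ψ → T ⨾ Γ ⊢ φ → T ⨾ Γ ⊢ ψ
  conv refl d = d

  ex-falso : T ⨾ Γ ⊢ ⊥ → T ⨾ Γ ⊢ φ
  ex-falso d = raa (weaken₁ d)

  cut : T ⨾ Γ ⊢ φ → T ⨾ φ ∷ Γ ⊢ ψ → T ⨾ Γ ⊢ ψ
  cut d e = ⇒-elim (⇒-intro e) d

  excluded-middle : T ⨾ Γ ⊢ φ ∨ ¬ φ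
  excluded-middle =
    raa (⇒-elim hyp₀ (∨-intro₂ (⇒-intro (⇒-elim hyp₁ (∨-intro₁ hyp₀)))))

  ⊤-intro : T ⨾ Γ ⊢ ⊤
  ⊤-intro = ⇒-intro hyp₀

  ⋁-intro : ∀ {A : Set} (g : A → Formula L m) (σ : Fin m → Term L n) {xs x} → x ∈ xs →
            T ⨾ Γ ⊢ sub σ (g x) → T ⨾ Γ ⊢ sub σ (⋁ (map g xs))
  ⋁-intro g σ (here refl) d = ∨-intro₁ d
  ⋁-intro g σ (there p)   d = ∨-intro₂ (⋁-intro g σ p d)

  ⋁-elim : ∀ {A : Set} (g : A → Formula L m) (σ : Fin m → Term L n) xs →
           T ⨾ Γ ⊢ sub σ (⋁ (map g xs)) → (∀ {x} → x ∈ xs → T ⨾ sub σ (g x) ∷ Γ ⊢ φ) → T ⨾ Γ ⊢ φ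
  ⋁-elim g σ []       d e = ex-falso d
  ⋁-elim g σ (x ∷ xs) d e = ∨-elim d (e (here refl))
    (⋁-elim g σ xs hyp₀ (λ p → weaken (∷⁺ʳ _ there) (e (there p))))

  -- `≐-subst` exchanges a single term. So the first variable is exchanged while the others keep
  -- their values from `σ`; its new value is then built into the formula, and induction does the
  -- rest.
  replace : ∀ k (θ : Formula L (k + n)) {σ τ : Fin k → Term L n} → (∀ i → T ⨾ Γ ⊢ σ i ≐ τ i) →
            T ⨾ Γ ⊢ sub (prepend k σ var) θ → T ⨾ Γ ⊢ sub (prepend k τ var) θ
  replace zero    θ eqs d = d
  replace (suc k) θ {σ} {τ} eqs d =
    conv (absorb (τ ∘ suc)) (replace k θ′ (eqs ∘ suc) (conv (sym (absorb (σ ∘ suc)))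
      (conv (sub-inst-liftS (prepend k (σ ∘ suc) var) (τ zero) θ)
        (≐-subst (sub (liftS (prepend k (σ ∘ suc) var)) θ) (eqs zero)
          (conv (sym (sub-inst-liftS (prepend k (σ ∘ suc) var) (σ zero) θ)) d)))))
    where
    θ′ = sub (renT (k ↑ʳ_) (τ zero) ▹ var) θ

    absorb : ∀ σ′ → sub (prepend k σ′ var) θ′ ≡ sub (τ zero ▹ prepend k σ′ var) θ
    absorb σ′ = trans (sub-sub (prepend k σ′ var) _ θ)
      (sub-cong (λ { zero → subT-prepend-↑ʳ k σ′ (τ zero) ; (suc i) → refl }) θ)

  leibniz : ∀ {k} (θ : Formula L k) {σ τ : Fin k → Term L n} → (∀ i → T ⨾ Γ ⊢ σ i ≐ τ i) →
            T ⨾ Γ ⊢ sub σ θ → T ⨾ Γ ⊢ sub τ θ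
  leibniz {k = k} θ {σ} {τ} eqs d =
    conv (sub-prepend-↑ˡ k τ θ)
      (replace k (ren (_↑ˡ _) θ) eqs (conv (sym (sub-prepend-↑ˡ k σ θ)) d))

  ≐-sym : ∀ {s t} → T ⨾ Γ ⊢ s ≐ t → T ⨾ Γ ⊢ t ≐ s
  ≐-sym {s = s} {t} d = leibniz (var 0F ≐ var 1F) {σ = s ▹ s ▹ ε} {τ = t ▹ s ▹ ε}
    (λ { 0F → d ; 1F → ≐-refl s }) (≐-refl s)

  ≐-trans : ∀ {s t u} → T ⨾ Γ ⊢ s ≐ t → T ⨾ Γ ⊢ t ≐ u → T ⨾ Γ ⊢ s ≐ u
  ≐-trans {s = s} {t} {u} d e = leibniz (var 0F ≐ var 1F) {σ = s ▹ t ▹ ε} {τ = s ▹ u ▹ ε}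
    (λ { 0F → ≐-refl s ; 1F → e }) d

  ≐-cong : ∀ (t : Term L 1) {s s′} → T ⨾ Γ ⊢ s ≐ s′ → T ⨾ Γ ⊢ subT (λ _ → s) t ≐ subT (λ _ → s′) t
  ≐-cong t {s} {s′} d = conv (cong₂ _≐_ (pt s s′ 0F) (pt s s′ 1F))
    (leibniz (renT (λ _ → 0F) t ≐ renT (λ _ → 1F) t) {σ = s ▹ s ▹ ε} {τ = s ▹ s′ ▹ ε}
      (λ { 0F → ≐-refl s ; 1F → d })
      (conv (sym (cong₂ _≐_ (pt s s 0F) (pt s s 1F))) (≐-refl _)))
    where
    pt : ∀ s s′ (i : Fin 2) → subT (s ▹ s′ ▹ ε) (renT (λ _ → i) t) ≡ subT (λ _ → (s ▹ s′ ▹ ε) i) t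
    pt s s′ i = subT-renT (s ▹ s′ ▹ ε) (λ _ → i) t

  ∃^-intro : ∀ k {φ : Formula L (k + n)} (σ : Fin k → Term L n) →
             T ⨾ Γ ⊢ sub (prepend k σ var) φ → T ⨾ Γ ⊢ ∃^ k φ
  ∃^-intro zero    {φ} σ d = conv (sub-var φ) d
  ∃^-intro (suc k) {φ} σ d = ∃^-intro k (σ ∘ suc)
    (∃-intro (σ zero) (conv (sym (sub-inst-liftS (prepend k (σ ∘ suc) var) (σ zero) φ)) d))

  -- The context holds just the existential formula, so that no other hypotheses are carried through
  -- the renamings; `cut` and weakening reach other contexts.
  ∃^-elim : ∀ k {φ : Formula L (k + n)} {χ} → T ⨾ φ ∷ [] ⊢ ren (k ↑ʳ_) χ → T ⨾ ∃^ k φ ∷ [] ⊢ χ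
  ∃^-elim zero    {φ} {χ} d = conv (trans (ren≡sub id χ) (sub-var χ)) d
  ∃^-elim (suc k) {φ} {χ} d = ∃^-elim k
    (∃-elim hyp₀ (weaken (∷⁺ʳ _ λ ()) (conv (sym (wk-ren χ)) d)))
    where
    wk-ren : ∀ χ → wk (ren (k ↑ʳ_) χ) ≡ ren (suc k ↑ʳ_) χ
    wk-ren χ = trans (cong wk (ren≡sub (k ↑ʳ_) χ))
      (trans (ren-sub suc (var ∘ (k ↑ʳ_)) χ) (sym (ren≡sub (suc k ↑ʳ_) χ)))

open VWSyntax

private variable
  k m n : ℕ
  Γ : List (Formula VWSig n)
  φ : Formula VWSig n

-- Words and their canonical terms

twos : ℕ → Word
twos m = replicate m 𝟐

≡twos⇒length : ∀ {m v} → v ≡ twos m → length v ≡ m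
≡twos⇒length {m} refl = length-replicate m

_≟ᴸ_ : DecidableEquality Letter
𝟏 ≟ᴸ 𝟏 = yes refl
𝟏 ≟ᴸ 𝟐 = no λ ()
𝟐 ≟ᴸ 𝟏 = no λ ()
𝟐 ≟ᴸ 𝟐 = yes refl

_≟ᵂ_ : DecidableEquality Word
_≟ᵂ_ = ≡-dec _≟ᴸ_

reverse-twos : ∀ m → reverse (twos m) ≡ twos m
reverse-twos zero    = refl
reverse-twos (suc m) =
  trans (unfold-reverse 𝟐 (twos m)) (trans (cong (_∷ʳ 𝟐) (reverse-twos m)) (snoc m))
  where
  snoc : ∀ m → twos m ∷ʳ 𝟐 ≡ 𝟐 ∷ twos m
  snoc zero    = refl
  snoc (suc m) = cong (𝟐 ∷_) (snoc m)

∈-wordsOfLength : ∀ w → w ∈ wordsOfLength (length w)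
∈-wordsOfLength []      = here refl
∈-wordsOfLength (d ∷ w) = ∈-concatMap⁺ _ (Any.map (λ { refl → last d }) (∈-wordsOfLength w))
  where
  last : ∀ d → (d ∷ w) ∈ (𝟏 ∷ w) ∷ (𝟐 ∷ w) ∷ []
  last 𝟏 = here refl
  last 𝟐 = there (here refl)

wordsOfLength⇒length : ∀ k {w} → w ∈ wordsOfLength k → length w ≡ k
wordsOfLength⇒length zero    (here refl) = refl
wordsOfLength⇒length (suc k) p = go (∈-concatMap⁻ _ p) (wordsOfLength⇒length k)
  where
  go : ∀ {w ws} → Any.Any (λ v → w ∈ (𝟏 ∷ v) ∷ (𝟐 ∷ v) ∷ []) ws →
       (∀ {v} → v ∈ ws → length v ≡ k) → length w ≡ suc k
  go (here (here refl))         h = cong suc (h (here refl))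
  go (here (there (here refl))) h = cong suc (h (here refl))
  go (there q)                  h = go q (h ∘ there)

∈-wordsUpTo : ∀ {m} w → length w ≤ m → w ∈ wordsUpTo m
∈-wordsUpTo {zero} [] l = here refl
∈-wordsUpTo {suc m} w l with m≤n⇒m<n∨m≡n l
... | inj₁ (s≤s l′) = ∈-++⁺ˡ (∈-wordsUpTo w l′)
... | inj₂ eq       = ∈-++⁺ʳ (wordsUpTo m) (subst (λ k → w ∈ wordsOfLength k) eq (∈-wordsOfLength w))

wordsUpTo⇒length : ∀ m {w} → w ∈ wordsUpTo m → length w ≤ m
wordsUpTo⇒length zero    (here refl) = z≤n
wordsUpTo⇒length (suc m) p with ∈-++⁻ (wordsUpTo m) p
... | inj₁ q = m≤n⇒m≤1+n (wordsUpTo⇒length m q)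
... | inj₂ q = ≤-reflexive (wordsOfLength⇒length (suc m) q)

infix 4 _≼_ _⊴_

data _≼_ (u : Word) : Word → Set where
  here  : u ≼ u
  there : ∀ {d v} → u ≼ v → u ≼ d ∷ v

-- VW6 describes `∣≤∣` below strings of 𝟐s, and VW7 leaves nothing below any other numeral
-- (`⊢¬∣≤∣`); hence the first conjunct.
_⊴_ : Word → Word → Set
u ⊴ v = v ≡ twos (length v) × length u ≤ length v

twos-⊴ : ∀ {m v} u → v ≡ twos m → length u ≤ m → u ⊴ v
twos-⊴ u eq l = trans eq (cong twos (sym (≡twos⇒length eq))) , ≤-trans l (≤-reflexive (sym (≡twos⇒length eq)))

[]≼ : ∀ v → [] ≼ v
[]≼ []      = here
[]≼ (d ∷ v) = there ([]≼ v)

_≼?_ : ∀ u v → Dec (u ≼ v)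
u ≼? [] with u ≟ᵂ []
... | yes refl = yes here
... | no u≢    = no λ { here → u≢ refl }
u ≼? (d ∷ v) with u ≟ᵂ (d ∷ v) | u ≼? v
... | yes refl | _     = yes here
... | no _     | yes p = yes (there p)
... | no u≢    | no ¬p = no λ { here → u≢ refl ; (there p) → ¬p p }

_⊴?_ : ∀ u v → Dec (u ⊴ v)
u ⊴? v = (v ≟ᵂ twos (length v)) ×-dec (length u ≤? length v)

-- The letters of w are read from the outermost S inwards, so that tm w is
-- the canonical term of the reversal of w.  In these terms ⊑ is the suffix
-- relation of lists.
tm : Word → Term VWSig n
tm = foldr S e

reverse-̲ : ∀ w → reverse w ̲ ≡ tm {n} w
reverse-̲ w = reverse-foldl _ e w

̲-reverse : ∀ w → w ̲ ≡ tm {n} (reverse w)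
̲-reverse w = sym (reverse-foldr _ e w)

subT-tm : (σ : Fin m → Term VWSig n) → ∀ w → subT σ (tm w) ≡ tm w
subT-tm σ []      = refl
subT-tm σ (d ∷ w) = cong (S d) (subT-tm σ w)

renT-tm : (ρ : Fin m → Fin n) → ∀ w → renT ρ (tm w) ≡ tm w
renT-tm ρ w = trans (renT≡subT ρ (tm w)) (subT-tm _ w)

subT-̲ : (σ : Fin m → Term VWSig n) → ∀ w → subT σ (w ̲) ≡ tm (reverse w)
subT-̲ σ w = trans (cong (subT σ) (̲-reverse w)) (subT-tm σ (reverse w))

subT-reverse-̲ : (σ : Fin m → Term VWSig n) → ∀ w → subT σ (reverse w ̲) ≡ tm w
subT-reverse-̲ σ w = trans (cong (subT σ) (reverse-̲ w)) (subT-tm σ w)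

-- Atomic formulas at canonical terms

axiom₀ : VW⁺ φ → VW⁺ ⨾ Γ ⊢ sub ε φ
axiom₀ {φ = φ} a = conv (trans (ren≡sub _ φ) (sub-cong (λ ()) φ)) (axiom a)

axiom₁ : VW⁺ (∀′ φ) → ∀ t → VW⁺ ⨾ Γ ⊢ sub (t ▹ ε) φ
axiom₁ {φ = φ} a t = conv (sub-inst-liftS ε t φ) (∀-elim (axiom₀ a) t)

⊢tm-≢ : ∀ u v → u ≢ v → VW⁺ ⨾ Γ ⊢ ¬ (tm u ≐ tm v)
⊢tm-≢ u v u≢v = conv (cong₂ (λ s t → ¬ (s ≐ t)) (subT-reverse-̲ ε u) (subT-reverse-̲ ε v))
  (axiom₀ (VW1 {reverse u} {reverse v} (u≢v ∘ reverse-injective)))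

⊢f-tm : ∀ w → VW⁺ ⨾ Γ ⊢ f (tm w) ≐ tm (reverse w)
⊢f-tm w = conv (cong₂ (λ s t → f s ≐ t) (subT-reverse-̲ ε w)
                 (trans (subT-̲ ε (reverse (reverse w))) (cong (tm ∘ reverse) (reverse-involutive w))))
  (axiom₀ (VW8 (reverse w)))

⊢⊑-S : ∀ t d w → VW⁺ ⨾ Γ ⊢ t ⊑ tm (d ∷ w) ⇔ (t ⊑ tm w ∨ t ≐ tm (d ∷ w))
⊢⊑-S t d w = conv (cong (λ u → t ⊑ S d u ⇔ (t ⊑ u ∨ t ≐ S d u)) (subT-reverse-̲ (t ▹ ε) w))
  (axiom₁ (VW5 (reverse w) d) t)

⊢≼ : ∀ u v → u ≼ v → VW⁺ ⨾ Γ ⊢ tm u ⊑ tm v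
⊢≼ []      _ here = conv (cong (e ⊑_) (subT-̲ ε [])) (axiom₀ (VW3 []))
⊢≼ (d ∷ u) _ here = ⇒-elim (∧-elim₂ (⊢⊑-S (tm (d ∷ u)) d u)) (∨-intro₂ (≐-refl _))
⊢≼ u (d ∷ v) (there p) = ⇒-elim (∧-elim₂ (⊢⊑-S (tm u) d v)) (∨-intro₁ (⊢≼ u v p))

-- VW4 and VW5 take `v` apart letter by letter. As `t` is any term, no element other than the
-- standard suffixes lies below a numeral.
⊑-elim : ∀ {t} v → VW⁺ ⨾ Γ ⊢ t ⊑ tm v → (∀ {u} → u ≼ v → VW⁺ ⨾ t ≐ tm u ∷ Γ ⊢ φ) → VW⁺ ⨾ Γ ⊢ φ
⊑-elim {t = t} []      p c = cut (⇒-elim (axiom₁ VW4 t) p) (c here)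
⊑-elim {t = t} (d ∷ v) p c = ∨-elim (⇒-elim (∧-elim₁ (⊢⊑-S t d v)) p)
  (⊑-elim v hyp₀ (λ q → weaken (∷⁺ʳ _ there) (c (there q))))
  (c here)

⊢¬≼ : ∀ u v → Not (u ≼ v) → VW⁺ ⨾ Γ ⊢ ¬ (tm u ⊑ tm v)
⊢¬≼ u v ¬p = ⇒-intro (⊑-elim v hyp₀
  (λ {w} q → ⇒-elim (⊢tm-≢ u w (λ { refl → ¬p q })) hyp₀))

⊢∣≤∣-twos : ∀ t m → VW⁺ ⨾ Γ ⊢
  t ∣≤∣ tm (twos m) ⇔ sub (t ▹ ε) (⋁ (map (λ s → var 0F ≐ s ̲) (wordsUpTo m)))
⊢∣≤∣-twos t m = conv
  (cong (λ u → t ∣≤∣ u ⇔ sub (t ▹ ε) (⋁ (map (λ s → var 0F ≐ s ̲) (wordsUpTo m))))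
    (trans (subT-̲ (t ▹ ε) (twos m)) (cong tm (reverse-twos m))))
  (axiom₁ (VW6 m) t)

⊢⊴-twos : ∀ m u → length u ≤ m → VW⁺ ⨾ Γ ⊢ tm u ∣≤∣ tm (twos m)
⊢⊴-twos m u l = ⇒-elim (∧-elim₂ (⊢∣≤∣-twos (tm u) m))
  (⋁-intro (λ s → var 0F ≐ s ̲) (tm u ▹ ε)
    (∈-wordsUpTo (reverse u) (subst (_≤ m) (sym (length-reverse u)) l))
    (conv (cong (tm u ≐_) (sym (subT-reverse-̲ _ u))) (≐-refl _)))

∣≤∣-twos-elim : ∀ {t} m → VW⁺ ⨾ Γ ⊢ t ∣≤∣ tm (twos m) →
                (∀ {u} → length u ≤ m → VW⁺ ⨾ t ≐ tm u ∷ Γ ⊢ φ) → VW⁺ ⨾ Γ ⊢ φ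
∣≤∣-twos-elim {φ = φ} {t = t} m p c = ⋁-elim (λ s → var 0F ≐ s ̲) (t ▹ ε) (wordsUpTo m)
  (⇒-elim (∧-elim₁ (⊢∣≤∣-twos t m)) p)
  (λ {u} q → subst (λ s → VW⁺ ⨾ t ≐ s ∷ _ ⊢ φ) (sym (subT-̲ (t ▹ ε) u))
    (c {reverse u} (subst (_≤ m) (sym (length-reverse u)) (wordsUpTo⇒length m q))))

find-𝟏 : ∀ v → v ≢ twos (length v) → ∃ λ u → 𝟏 ∷ u ≼ v
find-𝟏 []      ne = contradiction refl ne
find-𝟏 (𝟏 ∷ v) ne = v , here
find-𝟏 (𝟐 ∷ v) ne with find-𝟏 v (ne ∘ cong (𝟐 ∷_))
... | u , p = u , there p

𝟐-not-suffix : ∀ u → Not (𝟐 ∷ [] ≼ u ∷ʳ 𝟏)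
𝟐-not-suffix []          (there ())
𝟐-not-suffix (d ∷ [])    (there p) = 𝟐-not-suffix [] p
𝟐-not-suffix (d ∷ c ∷ u) (there p) = 𝟐-not-suffix (c ∷ u) p

-- If v has a letter 𝟏, some suffix 𝟏 ∷ u of v has a reversal that does not
-- satisfy VW7.
⊢¬∣≤∣ : ∀ {v} → v ≢ twos (length v) → ∀ t → VW⁺ ⨾ Γ ⊢ ¬ (t ∣≤∣ tm v)
⊢¬∣≤∣ {v = v} ne t with find-𝟏 v ne
... | u , p = ⇒-intro (⇒-elim (⊢¬≼ (𝟐 ∷ []) (reverse u ∷ʳ 𝟏) (𝟐-not-suffix (reverse u)))
  (leibniz (var 0F ⊑ var 1F)
    {σ = tm (𝟐 ∷ []) ▹ f (tm (𝟏 ∷ u)) ▹ ε} {τ = tm (𝟐 ∷ []) ▹ tm (reverse u ∷ʳ 𝟏) ▹ ε}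
    (λ { 0F → ≐-refl _
       ; 1F → conv (cong (λ x → f (tm (𝟏 ∷ u)) ≐ tm x) (unfold-reverse 𝟏 u)) (⊢f-tm (𝟏 ∷ u)) })
    (⇒-elim
      (conv (sub-inst-liftS ε (tm (𝟏 ∷ u))
              (var 0F ⊑ reverse v ̲ ∧ ¬ (var 0F ≐ e) ⇒ (𝟐 ∷ []) ̲ ⊑ f (var 0F)))
        (∀-elim (⇒-elim (axiom₀ (VW7 (reverse v))) (∃-intro t (conv t∣≤∣v hyp₀))) (tm (𝟏 ∷ u))))
      (∧-intro (conv (cong (tm (𝟏 ∷ u) ⊑_) (sym (subT-reverse-̲ _ v))) (⊢≼ (𝟏 ∷ u) v p))
        (⊢tm-≢ (𝟏 ∷ u) [] λ ())))))
  where
  t∣≤∣v : t ∣≤∣ tm v ≡ t ∣≤∣ subT (inst t) (subT (liftS ε) (reverse v ̲))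
  t∣≤∣v = cong (t ∣≤∣_)
    (sym (trans (cong (subT (inst t)) (subT-reverse-̲ (liftS ε) v)) (subT-tm (inst t) v)))

⊢⊴ : ∀ u v → u ⊴ v → VW⁺ ⨾ Γ ⊢ tm u ∣≤∣ tm v
⊢⊴ u v (eq , l) = conv (cong (λ w → tm u ∣≤∣ tm w) (sym eq)) (⊢⊴-twos (length v) u l)

∣≤∣-elim : ∀ {t} v → VW⁺ ⨾ Γ ⊢ t ∣≤∣ tm v → (∀ {u} → u ⊴ v → VW⁺ ⨾ t ≐ tm u ∷ Γ ⊢ φ) → VW⁺ ⨾ Γ ⊢ φ
∣≤∣-elim {t = t} v p c with v ≟ᵂ twos (length v)
... | yes eq = ∣≤∣-twos-elim (length v) (conv (cong (λ w → t ∣≤∣ tm w) eq) p)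
  (λ {u} l → c {u} (eq , l))
... | no ne  = ex-falso (⇒-elim (⊢¬∣≤∣ ne t) p)

⊢¬⊴ : ∀ u v → Not (u ⊴ v) → VW⁺ ⨾ Γ ⊢ ¬ (tm u ∣≤∣ tm v)
⊢¬⊴ u v ¬p = ⇒-intro (∣≤∣-elim v hyp₀
  (λ {w} q → ⇒-elim (⊢tm-≢ u w (λ { refl → ¬p q })) hyp₀))

-- Bounded formulas

infix 9 _⊑ᵇ_ _∣≤∣ᵇ_ _≐ᵇ_
infixr 7 _∧ᵇ_

-- A bound through `∣≤∣` leaves finitely many witnesses once the bounding variable is a numeral.
-- Disjunctions and bounded universal statements are expressed with `¬ᵇ`, `∧ᵇ` and `∃≤`.
data Bounded (n : ℕ) : Set where
  _⊑ᵇ_ _∣≤∣ᵇ_ _≐ᵇ_ : Term VWSig n → Term VWSig n → Bounded n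
  ¬ᵇ_              : Bounded n → Bounded n
  _∧ᵇ_             : Bounded n → Bounded n → Bounded n
  ∃≤               : Fin n → Bounded (suc n) → Bounded n

⌜_⌝ : Bounded n → Formula VWSig n
⌜ s ⊑ᵇ t ⌝   = s ⊑ t
⌜ s ∣≤∣ᵇ t ⌝ = s ∣≤∣ t
⌜ s ≐ᵇ t ⌝   = s ≐ t
⌜ ¬ᵇ φ ⌝     = ¬ ⌜ φ ⌝
⌜ φ ∧ᵇ ψ ⌝   = ⌜ φ ⌝ ∧ ⌜ ψ ⌝
⌜ ∃≤ x φ ⌝   = ∃′ (var 0F ∣≤∣ var (suc x) ∧ ⌜ φ ⌝)

eval : Term VWSig n → (Fin n → Word) → Word
eval (var x)                ρ = ρ x
eval (fun e-fun [])         ρ = []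
eval (fun f-fun (t ∷ []))   ρ = reverse (eval t ρ)
eval (fun (S-fun d) (t ∷ [])) ρ = d ∷ eval t ρ

⟦_⟧ : Bounded n → (Fin n → Word) → Set
⟦ s ⊑ᵇ t ⟧   ρ = eval s ρ ≼ eval t ρ
⟦ s ∣≤∣ᵇ t ⟧ ρ = eval s ρ ⊴ eval t ρ
⟦ s ≐ᵇ t ⟧   ρ = eval s ρ ≡ eval t ρ
⟦ ¬ᵇ φ ⟧     ρ = Not (⟦ φ ⟧ ρ)
⟦ φ ∧ᵇ ψ ⟧   ρ = ⟦ φ ⟧ ρ × ⟦ ψ ⟧ ρ
⟦ ∃≤ x φ ⟧   ρ = ∃ λ u → u ⊴ ρ x × ⟦ φ ⟧ (u ▹ ρ)

any-⊴? : {P : Word → Set} → (∀ u → Dec (P u)) → ∀ v → Dec (∃ λ u → u ⊴ v × P u)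
any-⊴? {P} P? v with v ≟ᵂ twos (length v)
... | no ne  = no λ (_ , (eq , _) , _) → ne eq
... | yes eq = map′ to from (Any.any? P? (wordsUpTo (length v)))
  where
  to : Any.Any P (wordsUpTo (length v)) → ∃ λ u → u ⊴ v × P u
  to a = let (u , p , q) = find a in u , (eq , wordsUpTo⇒length (length v) p) , q
  from : (∃ λ u → u ⊴ v × P u) → Any.Any P (wordsUpTo (length v))
  from (u , (_ , l) , q) = Any.map (λ { refl → q }) (∈-wordsUpTo u l)

dec : (φ : Bounded n) → ∀ ρ → Dec (⟦ φ ⟧ ρ)
dec (s ⊑ᵇ t)   ρ = eval s ρ ≼? eval t ρ
dec (s ∣≤∣ᵇ t) ρ = eval s ρ ⊴? eval t ρ
dec (s ≐ᵇ t)   ρ = eval s ρ ≟ᵂ eval t ρ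
dec (¬ᵇ φ)     ρ = ¬? (dec φ ρ)
dec (φ ∧ᵇ ψ)   ρ = dec φ ρ ×-dec dec ψ ρ
dec (∃≤ x φ)   ρ = any-⊴? (λ u → dec φ (u ▹ ρ)) (ρ x)

⊢eval : ∀ {k} (t : Term VWSig k) (ρ : Fin k → Word) → VW⁺ ⨾ Γ ⊢ subT (tm ∘ ρ) t ≐ tm (eval t ρ)
⊢eval (var x)                  ρ = ≐-refl _
⊢eval (fun e-fun [])           ρ = ≐-refl _
⊢eval (fun f-fun (t ∷ []))     ρ = ≐-trans (≐-cong (f (var 0F)) (⊢eval t ρ)) (⊢f-tm (eval t ρ))
⊢eval (fun (S-fun d) (t ∷ [])) ρ = ≐-cong (S d (var 0F)) (⊢eval t ρ)

tm-▹ : ∀ (u : Word) (ρ : Fin k → Word) (φ : Formula VWSig (suc k)) →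
       sub (tm {n} u ▹ tm ∘ ρ) φ ≡ sub (tm ∘ (u ▹ ρ)) φ
tm-▹ u ρ = sub-cong (λ { zero → refl ; (suc i) → refl })

⊢evals : ∀ (θ : Formula VWSig 2) (s t : Term VWSig k) (ρ : Fin k → Word) →
         VW⁺ ⨾ Γ ⊢ sub (tm (eval s ρ) ▹ tm (eval t ρ) ▹ ε) θ →
         VW⁺ ⨾ Γ ⊢ sub (subT (tm ∘ ρ) s ▹ subT (tm ∘ ρ) t ▹ ε) θ
⊢evals θ s t ρ = leibniz θ (λ { 0F → ≐-sym (⊢eval s ρ) ; 1F → ≐-sym (⊢eval t ρ) })

-- Simultaneous induction. A false `∃≤` is refuted by `∣≤∣-elim`, which replaces an arbitrary
-- witness by a numeral. The metatheory being constructive, `dec` tells which conjunct fails and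
-- removes double negations.
⊢true  : ∀ {k} (φ : Bounded k) {ρ} → ⟦ φ ⟧ ρ → VW⁺ ⨾ Γ ⊢ sub (tm ∘ ρ) ⌜ φ ⌝
⊢false : ∀ {k} (φ : Bounded k) {ρ} → Not (⟦ φ ⟧ ρ) → VW⁺ ⨾ Γ ⊢ ¬ sub (tm ∘ ρ) ⌜ φ ⌝

⊢true (s ⊑ᵇ t) {ρ} p   = ⊢evals (var 0F ⊑ var 1F) s t ρ (⊢≼ (eval s ρ) (eval t ρ) p)
⊢true (s ∣≤∣ᵇ t) {ρ} p = ⊢evals (var 0F ∣≤∣ var 1F) s t ρ (⊢⊴ (eval s ρ) (eval t ρ) p)
⊢true (s ≐ᵇ t) {ρ} p   = ⊢evals (var 0F ≐ var 1F) s t ρ (conv (cong (λ w → tm (eval s ρ) ≐ tm w) p) (≐-refl _))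
⊢true (¬ᵇ φ) p = ⊢false φ p
⊢true (φ ∧ᵇ ψ) (p , q) = ∧-intro (⊢true φ p) (⊢true ψ q)
⊢true (∃≤ x φ) {ρ} (u , l , p) = ∃-intro (tm u) (∧-intro
  (conv (cong (tm u ∣≤∣_) (sym (inst-renT-suc (tm u) (tm (ρ x))))) (⊢⊴ u (ρ x) l))
  (conv (sym (trans (sub-inst-liftS (tm ∘ ρ) (tm u) ⌜ φ ⌝) (tm-▹ u ρ ⌜ φ ⌝))) (⊢true φ p)))

⊢false (s ⊑ᵇ t) {ρ} p   = ⊢evals (¬ (var 0F ⊑ var 1F)) s t ρ (⊢¬≼ (eval s ρ) (eval t ρ) p)
⊢false (s ∣≤∣ᵇ t) {ρ} p = ⊢evals (¬ (var 0F ∣≤∣ var 1F)) s t ρ (⊢¬⊴ (eval s ρ) (eval t ρ) p)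
⊢false (s ≐ᵇ t) {ρ} p   = ⊢evals (¬ (var 0F ≐ var 1F)) s t ρ (⊢tm-≢ (eval s ρ) (eval t ρ) p)
⊢false (¬ᵇ φ) {ρ} p with dec φ ρ
... | yes q = ⇒-intro (⇒-elim hyp₀ (⊢true φ q))
... | no ¬q = contradiction ¬q p
⊢false (φ ∧ᵇ ψ) {ρ} p with dec φ ρ
... | yes q = ⇒-intro (⇒-elim (⊢false ψ (λ r → p (q , r))) (∧-elim₂ hyp₀))
... | no ¬q = ⇒-intro (⇒-elim (⊢false φ ¬q) (∧-elim₁ hyp₀))
⊢false (∃≤ x φ) {ρ} p = ⇒-intro (∃-elim hyp₀
  (∣≤∣-elim (ρ x) (conv (cong (var 0F ∣≤∣_) (renT-tm suc (ρ x))) (∧-elim₁ hyp₀))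
    (λ {u} l → ⇒-elim (⊢false φ (λ q → p (u , l , q)))
      (leibniz ⌜ φ ⌝
        (λ { zero → hyp₀ ; (suc i) → conv (cong (_≐ tm (ρ i)) (sym (renT-tm suc (ρ i)))) (≐-refl _) })
        (∧-elim₂ hyp₁)))))

-- Definable relations between words

twos-𝟏-injective : ∀ k l {a b} → twos k ++ 𝟏 ∷ a ≡ twos l ++ 𝟏 ∷ b → k ≡ l × a ≡ b
twos-𝟏-injective zero    zero    refl = refl , refl
twos-𝟏-injective (suc k) (suc l) eq with twos-𝟏-injective k l (∷-injectiveʳ eq)
... | refl , eq′ = refl , eq′

++-injectiveˡ-length : ∀ (a b : Word) {c d} → a ++ c ≡ b ++ d → length a ≡ length b → a ≡ b
++-injectiveˡ-length []      []      eq l = refl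
++-injectiveˡ-length (x ∷ a) (y ∷ b) eq l with ∷-injective eq
... | refl , eq′ = cong (x ∷_) (++-injectiveˡ-length a b eq′ (suc-injective l))

twos-no-𝟏 : ∀ l a {b} → twos l ≢ a ++ 𝟏 ∷ b
twos-no-𝟏 (suc l) []      ()
twos-no-𝟏 (suc l) (_ ∷ a) eq = twos-no-𝟏 l a (∷-injectiveʳ eq)

only-𝟏 : ∀ k l a {b} → twos k ++ 𝟏 ∷ twos l ≡ a ++ 𝟏 ∷ b → b ≡ twos l
only-𝟏 zero    l []      refl = refl
only-𝟏 zero    l (_ ∷ a) eq   = ⊥-elim (twos-no-𝟏 l a (∷-injectiveʳ eq))
only-𝟏 (suc k) l (_ ∷ a) eq   = only-𝟏 k l a (∷-injectiveʳ eq)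

≼-++ : ∀ a {u} → u ≼ a ++ u
≼-++ []      = here
≼-++ (_ ∷ a) = there (≼-++ a)

≼⇒++ : ∀ {u v} → u ≼ v → ∃ λ a → v ≡ a ++ u
≼⇒++ here = [] , refl
≼⇒++ (there {d} p) with ≼⇒++ p
... | a , refl = d ∷ a , refl

≼-trans : ∀ {u v w} → u ≼ v → v ≼ w → u ≼ w
≼-trans p here      = p
≼-trans p (there q) = there (≼-trans p q)

-- Prefixes are handled as suffixes of reversals; in formulas, `f` serves this purpose.
reverse-≼ : ∀ u b → reverse u ≼ reverse (u ++ b)
reverse-≼ u b = subst (reverse u ≼_) (sym (reverse-++ u b)) (≼-++ (reverse b))

reverse-≼⇒++ : ∀ u v → reverse u ≼ reverse v → ∃ λ b → v ≡ u ++ b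
reverse-≼⇒++ u v p with ≼⇒++ p
... | a , eq = reverse a , trans (sym (reverse-involutive v))
  (trans (cong reverse eq)
    (trans (reverse-++ a (reverse u)) (cong (_++ reverse a) (reverse-involutive u))))

≼-length : ∀ {u v} → u ≼ v → length u ≤ length v
≼-length here      = ≤-refl
≼-length (there p) = m≤n⇒m≤1+n (≼-length p)

nodeWord : Word → Word
nodeWord c = twos (length c) ++ 𝟏 ∷ c

-- The first conjunct makes `p` a string of 𝟐s at least as long as `x`; by the second, a word with
-- one letter more no longer fits. The letter 𝟏 is an arbitrary choice.
sameLength : Fin n → Fin n → Bounded n
sameLength x p = var x ∣≤∣ᵇ var p ∧ᵇ ¬ᵇ (S 𝟏 (var x) ∣≤∣ᵇ var p)

sameLength-sound : ∀ {x p} {ρ : Fin n → Word} → ⟦ sameLength x p ⟧ ρ → ρ p ≡ twos (length (ρ x))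
sameLength-sound {x = x} {p} {ρ} ((eq , l) , ¬l) with m≤n⇒m<n∨m≡n l
... | inj₁ l′  = contradiction (eq , l′) ¬l
... | inj₂ eq′ = trans eq (cong twos (sym eq′))

sameLength-complete : ∀ {x p} {ρ : Fin n → Word} → ρ p ≡ twos (length (ρ x)) → ⟦ sameLength x p ⟧ ρ
sameLength-complete {x = x} {p} {ρ} eq =
  twos-⊴ (ρ x) eq ≤-refl , λ (_ , l) → <-irrefl (sym (≡twos⇒length eq)) l

-- z = x ++ 𝟏 ∷ y.  Its length is that of a word q = i ++ 𝟏 ∷ j, where i and j
-- are strings of 𝟐s as long as x and y; q is singled out by having no other 𝟏.
concat : Fin n → Fin n → Fin n → Fin n → Bounded n
concat x y z w =
  f (var x) ⊑ᵇ f (var z) ∧ᵇ S 𝟏 (var y) ⊑ᵇ var z ∧ᵇ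
  ∃≤ w (∃≤ (suc w) (∃≤ (suc (suc w)) (∃≤ (suc (suc (suc w)))
    (sameLength (suc (suc (suc (suc x)))) 2F ∧ᵇ sameLength (suc (suc (suc (suc y)))) 1F ∧ᵇ
     sameLength 3F 0F ∧ᵇ sameLength (suc (suc (suc (suc z)))) 0F ∧ᵇ
     S 𝟏 (f (var 2F)) ⊑ᵇ f (var 3F) ∧ᵇ
     ¬ᵇ ∃≤ (suc (suc (suc (suc w))))
       (var 0F ⊑ᵇ var (suc 3F) ∧ᵇ S 𝟏 e ⊑ᵇ f (var 0F) ∧ᵇ ¬ᵇ (var 0F ≐ᵇ S 𝟏 (var 2F)))))))

-- The prefix `x` and the suffix `𝟏 ∷ y` of `z` might overlap or leave a gap; comparing lengths
-- excludes both. The string `r` of 𝟐s transfers the length of `q` to `z`, since `sameLength`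
-- compares a word with a string of 𝟐s only.
concat-sound : ∀ {x y z w} {ρ : Fin n → Word} → ⟦ concat x y z w ⟧ ρ → ρ z ≡ ρ x ++ 𝟏 ∷ ρ y
concat-sound {x = x} {y} {z} {w} {ρ}
  (p , s , q , (wq , lq) , i , _ , j , _ , r , _ , hi , hj , hq , hz , pre , only)
  with reverse-≼⇒++ (ρ x) (ρ z) p | ≼⇒++ s
     | reverse-≼⇒++ (i ++ 𝟏 ∷ []) q (subst (_≼ reverse q) (sym (reverse-++ i (𝟏 ∷ []))) pre)
... | b , z≡x++b | a , z≡a++𝟏y | c , q≡i𝟏c =
  trans z≡a++𝟏y (cong (_++ 𝟏 ∷ ρ y) (++-injectiveˡ-length a (ρ x) (trans (sym z≡a++𝟏y) z≡x++b) |a|≡|x|))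
  where
  q≡ : q ≡ i ++ 𝟏 ∷ c
  q≡ = trans q≡i𝟏c (++-assoc i (𝟏 ∷ []) c)
  𝟏c≼q : 𝟏 ∷ c ≼ q
  𝟏c≼q = subst (𝟏 ∷ c ≼_) (sym q≡) (≼-++ i)
  -- The 𝟏 after `i` starts a suffix of `q`, and the last clause of `concat` admits only `𝟏 ∷ j`.
  -- That clause is a negated existence, hence the appeal to decidable equality.
  c≡j : 𝟏 ∷ c ≡ 𝟏 ∷ j
  c≡j = decidable-stable ((𝟏 ∷ c) ≟ᵂ (𝟏 ∷ j)) λ ne →
    only (𝟏 ∷ c , (wq , ≤-trans (≼-length 𝟏c≼q) lq) , 𝟏c≼q , reverse-≼ (𝟏 ∷ []) c , ne)
  env = r ▹ j ▹ i ▹ q ▹ ρ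
  |p|≡ : ∀ a p → ⟦ sameLength a p ⟧ env → length (env p) ≡ length (env a)
  |p|≡ a p h = ≡twos⇒length {v = env p} (sameLength-sound {x = a} {p} {env} h)
  |z|≡|q| : length (ρ z) ≡ length q
  |z|≡|q| = trans (sym (|p|≡ (suc (suc (suc (suc z)))) 0F hz)) (|p|≡ 3F 0F hq)
  open ≡-Reasoning
  |a|≡|x| : length a ≡ length (ρ x)
  |a|≡|x| = +-cancelʳ-≡ (suc (length (ρ y))) _ _ (begin
    length a + suc (length (ρ y))     ≡⟨ sym (length-++ a) ⟩
    length (a ++ 𝟏 ∷ ρ y)             ≡⟨ cong length (sym z≡a++𝟏y) ⟩
    length (ρ z)                      ≡⟨ |z|≡|q| ⟩
    length q                          ≡⟨ cong length (trans q≡ (cong (i ++_) c≡j)) ⟩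
    length (i ++ 𝟏 ∷ j)               ≡⟨ length-++ i ⟩
    length i + suc (length j)         ≡⟨ cong₂ (λ k l → k + suc l)
                                           (|p|≡ (suc (suc (suc (suc x)))) 2F hi)
                                           (|p|≡ (suc (suc (suc (suc y)))) 1F hj) ⟩
    length (ρ x) + suc (length (ρ y)) ∎)

-- No witness is longer than `z`, so a bound for `z` bounds them all.
concat-complete : ∀ {x y z w} {ρ : Fin n → Word} → ρ z ⊴ ρ w → ρ z ≡ ρ x ++ 𝟏 ∷ ρ y → ⟦ concat x y z w ⟧ ρ
concat-complete {x = x} {y} {z} {w} {ρ} (wt , l) eq =
  subst (λ v → reverse (ρ x) ≼ reverse v) (sym eq) (reverse-≼ (ρ x) (𝟏 ∷ ρ y)) ,
  subst (𝟏 ∷ ρ y ≼_) (sym eq) (≼-++ (ρ x)) ,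
  q , (wt , ≤-trans (≤-reflexive |q|) l) ,
  i , (wt , bound (length (ρ x)) (m≤m+n _ _)) ,
  j , (wt , bound (length (ρ y)) (≤-trans (n≤1+n _) (m≤n+m _ (length (ρ x))))) ,
  r , (wt , ≤-trans (≤-reflexive (length-replicate _)) l) ,
  sameLength-complete {x = suc (suc (suc (suc x)))} {2F} {env} refl ,
  sameLength-complete {x = suc (suc (suc (suc y)))} {1F} {env} refl ,
  sameLength-complete {x = 3F} {0F} {env} (cong twos (sym |q|)) ,
  sameLength-complete {x = suc (suc (suc (suc z)))} {0F} {env} refl ,
  subst (_≼ reverse q) (reverse-++ i (𝟏 ∷ []))
    (subst (λ v → reverse (i ++ 𝟏 ∷ []) ≼ reverse v) (++-assoc i (𝟏 ∷ []) j)
      (reverse-≼ (i ++ 𝟏 ∷ []) j)) ,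
  only
  where
  i j q r : Word
  i = twos (length (ρ x))
  j = twos (length (ρ y))
  q = i ++ 𝟏 ∷ j
  r = twos (length (ρ z))
  env = r ▹ j ▹ i ▹ q ▹ ρ
  |z| : length (ρ z) ≡ length (ρ x) + suc (length (ρ y))
  |z| = trans (cong length eq) (length-++ (ρ x))
  bound : ∀ k → k ≤ length (ρ x) + suc (length (ρ y)) → length (twos k) ≤ length (ρ w)
  bound k k≤ = ≤-trans (≤-reflexive (length-replicate k)) (≤-trans k≤ (≤-trans (≤-reflexive (sym |z|)) l))
  |q| : length q ≡ length (ρ z)
  |q| = trans (length-++ i)
    (trans (cong₂ (λ k l → k + suc l) (length-replicate _) (length-replicate _)) (sym |z|))
  only : Not (∃ λ u → u ⊴ ρ w × u ≼ q × (𝟏 ∷ [] ≼ reverse u) × Not (u ≡ 𝟏 ∷ j))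
  only (u , _ , u≼q , p , ne) with reverse-≼⇒++ (𝟏 ∷ []) u p
  ... | b , refl with ≼⇒++ u≼q
  ... | a , eq′ = ne (cong (𝟏 ∷_) (only-𝟏 (length (ρ x)) (length (ρ y)) a eq′))

node : Fin n → Fin n → Fin n → Bounded n
node c z w = ∃≤ w (sameLength (suc c) 0F ∧ᵇ concat 0F (suc c) (suc z) (suc w))

node-sound : ∀ {c z w} {ρ : Fin n → Word} → ⟦ node c z w ⟧ ρ → ρ z ≡ nodeWord (ρ c)
node-sound {c = c} {z} {w} {ρ} (p , _ , hp , hz) =
  trans (concat-sound {x = 0F} {suc c} {suc z} {suc w} {p ▹ ρ} hz)
    (cong (_++ 𝟏 ∷ ρ c) (sameLength-sound {x = suc c} {0F} {p ▹ ρ} hp))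

node-complete : ∀ {c z w} {ρ : Fin n → Word} → ρ z ⊴ ρ w → ρ z ≡ nodeWord (ρ c) → ⟦ node c z w ⟧ ρ
node-complete {c = c} {z} {w} {ρ} (wt , l) eq =
  p , (wt , ≤-trans (m≤m+n _ _) (≤-trans (≤-reflexive |z|) l)) ,
  sameLength-complete {x = suc c} {0F} {p ▹ ρ} refl ,
  concat-complete {x = 0F} {suc c} {suc z} {suc w} {p ▹ ρ} (wt , l) eq
  where
  p : Word
  p = twos (length (ρ c))
  |z| : length p + suc (length (ρ c)) ≡ length (ρ z)
  |z| = trans (sym (length-++ p)) (sym (cong length eq))

≼-nodeWord : ∀ c → c ≼ nodeWord c
≼-nodeWord c = ≼-trans (there here) (≼-++ (twos (length c)))

-- formula w z ps, with w bounding its quantifiers, says that z is a value of the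
-- predicate at the arguments ps.
record Predicate (k : ℕ) : Set₁ where
  field
    formula  : ∀ {n} → Fin n → Fin n → (Fin k → Fin n) → Bounded n
    Holds    : Word → Word → (Fin k → Word) → Set
    natural  : ∀ {m n} (ξ : Fin m → Fin n) w z ps →
               ren ξ ⌜ formula w z ps ⌝ ≡ ⌜ formula (ξ w) (ξ z) (ξ ∘ ps) ⌝
    sound    : ∀ {n} w z ps (ρ : Fin n → Word) → ⟦ formula w z ps ⟧ ρ → Holds (ρ w) (ρ z) (ρ ∘ ps)
    complete : ∀ {n} w z ps (ρ : Fin n → Word) → Holds (ρ w) (ρ z) (ρ ∘ ps) → ⟦ formula w z ps ⟧ ρ

-- In the code of a tree, the coded subtrees start at the first letter and after
-- every 𝟏 other than the last letter.
Begins : Word → Word → Set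
Begins u y = u ≡ y ⊎ 𝟏 ∷ u ≼ y

begins-≼ : ∀ {u y} → Begins u y → u ≼ y
begins-≼ (inj₁ refl) = here
begins-≼ (inj₂ p)    = ≼-trans (there here) p

begins-length : ∀ z {b y} → Begins (z ++ b) y → length z ≤ length y
begins-length z h =
  ≤-trans (subst (length z ≤_) (sym (length-++ z)) (m≤m+n _ _)) (≼-length (begins-≼ h))

-- Bounded formulas have no disjunction, so the two cases of `Begins` appear doubly negated; both
-- are decidable, which recovers the disjunction.
begins-decode : ∀ z u y → reverse z ≼ reverse u → Not (Not (u ≡ y) × Not (𝟏 ∷ u ≼ y)) →
                ∃ λ b → Begins (z ++ b) y
begins-decode z u y pre h with reverse-≼⇒++ z u pre
... | b , refl with u ≟ᵂ y | (𝟏 ∷ u) ≼? y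
... | yes p | _     = b , inj₁ p
... | no _  | yes q = b , inj₂ q
... | no ¬p | no ¬q = contradiction (¬p , ¬q) h

-- `sameLength z w` ties the bound to the value: the arguments determine `z` and thereby `w`, as the
-- search for a least bound requires.
pairPredicate : Predicate 2
pairPredicate = record
  { formula = λ w z ps → sameLength z w ∧ᵇ
      ∃≤ w (node 0F (suc z) (suc w) ∧ᵇ concat (suc (ps 0F)) (suc (ps 1F)) 0F (suc w))
  ; Holds = λ w z ps → w ≡ twos (length z) × z ≡ nodeWord (ps 0F ++ 𝟏 ∷ ps 1F)
  ; natural = λ ξ w z ps → refl
  ; sound = λ w z ps ρ (hw , c , _ , hz , hc) →
      sameLength-sound {x = z} {w} {ρ} hw ,
      trans (node-sound {c = 0F} {suc z} {suc w} {c ▹ ρ} hz)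
        (cong nodeWord (concat-sound {x = suc (ps 0F)} {suc (ps 1F)} {0F} {suc w} {c ▹ ρ} hc))
  ; complete = λ w z ps ρ (hw , hz) →
      let c   = ρ (ps 0F) ++ 𝟏 ∷ ρ (ps 1F)
          z⊴w = twos-⊴ (ρ z) hw ≤-refl
          c⊴w = twos-⊴ c hw (≼-length (subst (c ≼_) (sym hz) (≼-nodeWord c)))
      in sameLength-complete {x = z} {w} {ρ} hw ,
         c , c⊴w ,
         node-complete {c = 0F} {suc z} {suc w} {c ▹ ρ} z⊴w hz ,
         concat-complete {x = suc (ps 0F)} {suc (ps 1F)} {0F} {suc w} {c ▹ ρ} c⊴w refl
  }

-- Here the bound is tied to the argument, since subterms of different lengths have to share it. The
-- first quantifier finds the rest of the argument from the place where `z` starts; the second finds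
-- the content of `z`.
subtermPredicate : Predicate 1
subtermPredicate = record
  { formula = λ w z ps → sameLength (ps 0F) w ∧ᵇ
      ∃≤ w (f (var (suc z)) ⊑ᵇ f (var 0F) ∧ᵇ
            ¬ᵇ (¬ᵇ (var 0F ≐ᵇ var (suc (ps 0F))) ∧ᵇ ¬ᵇ (S 𝟏 (var 0F) ⊑ᵇ var (suc (ps 0F))))) ∧ᵇ
      ∃≤ w (node 0F (suc z) (suc w))
  ; Holds = λ w z ps → w ≡ twos (length (ps 0F)) × (∃ λ b → Begins (z ++ b) (ps 0F)) ×
                       (∃ λ v → z ≡ nodeWord v)
  ; natural = λ ξ w z ps → refl
  ; sound = λ w z ps ρ (hw , (u , _ , pre , h) , (v , _ , hv)) →
      sameLength-sound {x = ps 0F} {w} {ρ} hw ,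
      begins-decode (ρ z) u (ρ (ps 0F)) pre h ,
      v , node-sound {c = 0F} {suc z} {suc w} {v ▹ ρ} hv
  ; complete = λ w z ps ρ (hw , (b , h) , (v , hz)) →
      let z⊴w = twos-⊴ (ρ z) hw (begins-length (ρ z) h)
          v⊴w = twos-⊴ v hw
                  (≤-trans (≼-length (subst (v ≼_) (sym hz) (≼-nodeWord v))) (begins-length (ρ z) h))
      in sameLength-complete {x = ps 0F} {w} {ρ} hw ,
         (ρ z ++ b , twos-⊴ (ρ z ++ b) hw (≼-length (begins-≼ h)) , reverse-≼ (ρ z) b ,
          λ (¬p , ¬q) → [ ¬p , ¬q ]′ h) ,
         (v , v⊴w , node-complete {c = 0F} {suc z} {suc w} {v ▹ ρ} z⊴w hz)
  }

open Predicate

-- Least bounds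

-- A nice w is a power 2^j with j < m or has 2^m ⊑ w, for each numeral m (see
-- climb); this stands in for the comparability of w with 2^m.
nice : Fin n → Bounded n
nice w = e ⊑ᵇ var w ∧ᵇ e ∣≤∣ᵇ var w ∧ᵇ
  ¬ᵇ ∃≤ w (var 0F ⊑ᵇ var (suc w) ∧ᵇ ¬ᵇ (var 0F ≐ᵇ var (suc w)) ∧ᵇ
    ¬ᵇ (S 𝟐 (var 0F) ⊑ᵇ var (suc w) ∧ᵇ S 𝟐 (var 0F) ∣≤∣ᵇ var (suc w)))

-- A proper suffix of a string of 𝟐s is a shorter one, and with one more 𝟐 it is still a suffix.
nice-complete : ∀ k {w} {ρ : Fin n → Word} → ρ w ≡ twos k → ⟦ nice w ⟧ ρ
nice-complete k {w} {ρ} eq =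
  []≼ (ρ w) , twos-⊴ [] eq z≤n , λ (u , _ , u≼w , u≢w , h) →
    let 𝟐u≼ = 𝟐u≼w u≼w u≢w
    in h (𝟐u≼ , twos-⊴ (𝟐 ∷ u) eq (≤-trans (≼-length 𝟐u≼) (≤-reflexive (≡twos⇒length eq))))
  where
  step : ∀ k {u} → u ≼ twos k → u ≢ twos k → 𝟐 ∷ u ≼ twos k
  step zero    here      ne = contradiction refl ne
  step (suc k) here      ne = contradiction refl ne
  step (suc k) {u} (there p) ne with u ≟ᵂ twos k
  ... | yes refl = here
  ... | no ne′   = there (step k p ne′)
  𝟐u≼w : ∀ {u} → u ≼ ρ w → u ≢ ρ w → 𝟐 ∷ u ≼ ρ w
  𝟐u≼w p ne =
    subst (𝟐 ∷ _ ≼_) (sym eq) (step k (subst (_ ≼_) eq p) (λ q → ne (trans q (sym eq))))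

-- The closure clause of `nice` takes both relations for `u` and returns both for `S 𝟐 u`.
reached : Fin n → ℕ → Formula VWSig n
reached i m = tm (twos m) ⊑ var i ∧ tm (twos m) ∣≤∣ var i

-- Induction on `m` outside the theory: the first clauses of `nice` reach `e`, and once a power is
-- reached, either it is `var i` or the closure clause reaches the next.
climb : ∀ m {i : Fin n} → VW⁺ ⨾ Γ ⊢ sub (λ _ → var i) ⌜ nice {1} 0F ⌝ →
        (∀ j → j < m → VW⁺ ⨾ tm (twos j) ≐ var i ∷ Γ ⊢ φ) →
        VW⁺ ⨾ reached i m ∷ Γ ⊢ φ → VW⁺ ⨾ Γ ⊢ φ
climb zero    N c r = cut (∧-intro (∧-elim₁ N) (∧-elim₁ (∧-elim₂ N))) r
climb (suc m) {i} N c r = climb m N (λ j l → c j (m≤n⇒m≤1+n l))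
  (∨-elim (excluded-middle {φ = tm (twos m) ≐ var i})
    (weaken (∷⁺ʳ _ there) (c m ≤-refl))
    -- The closure clause only denies a counterexample, so the next stage is obtained by
    -- contradiction.
    (cut (raa (⇒-elim (weaken (λ q → there (there (there q))) (∧-elim₂ (∧-elim₂ N)))
            (∃-intro (tm (twos m)) (∧-intro (∧-elim₂ (weaken₁ hyp₁))
              (∧-intro (∧-elim₁ (weaken₁ hyp₁)) (∧-intro hyp₁ hyp₀))))))
      (weaken (∷⁺ʳ _ (λ q → there (there q))) r)))

module _ (G : Predicate k) where

  -- w is a nice bound at which z is a value of G, and no proper prefix w′ of w
  -- bounds a value of G.
  matrix : Bounded (2 + k)
  matrix = nice 0F ∧ᵇ var 1F ∣≤∣ᵇ var 0F ∧ᵇ formula G 0F 1F (2 ↑ʳ_) ∧ᵇ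
    ¬ᵇ ∃≤ 0F (var 0F ⊑ᵇ var 1F ∧ᵇ ¬ᵇ (var 0F ≐ᵇ var 1F) ∧ᵇ
      ∃≤ 0F (formula G 1F 0F (4 ↑ʳ_)))

  opaque
    first : Formula VWSig (suc k)
    first = ∃′ ⌜ matrix ⌝

    first≡∃matrix : first ≡ ∃′ ⌜ matrix ⌝
    first≡∃matrix = refl

  -- At the numerals `ρ` the values of `G` among words are those in `Z`, all with the one bound
  -- `twos m`. `⊢oneOf` extends this to arbitrary elements.
  module _ {ρ : Fin k → Word} {m : ℕ} {Z : List Word}
           (solutions : ∀ w z → Holds G w z ρ → w ≡ twos m × z ∈ Z)
           (holds : ∀ {z} → z ∈ Z → Holds G (twos m) z ρ)
           (short : ∀ {z} → z ∈ Z → length z ≤ m) where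

    ⊢first : ∀ {z} → z ∈ Z → VW⁺ ⨾ Γ ⊢ sub (tm z ▹ tm ∘ ρ) first
    ⊢first {z = z} p =
      conv (trans (sym (tm-▹ z ρ (∃′ ⌜ matrix ⌝))) (cong (sub (tm z ▹ tm ∘ ρ)) (sym first≡∃matrix)))
        (∃-intro (tm (twos m))
          (conv (sym (trans (sub-inst-liftS (tm ∘ (z ▹ ρ)) (tm (twos m)) ⌜ matrix ⌝)
                       (tm-▹ (twos m) (z ▹ ρ) ⌜ matrix ⌝)))
            (⊢true matrix
              (nice-complete m {0F} {env} refl , twos-⊴ z refl (short p) ,
               complete G 0F 1F (2 ↑ʳ_) env (holds p) ,
               -- Minimality: `solutions` admits no bound other than `twos m`.
               λ (w , _ , _ , ne , (z′ , _ , h)) →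
                 ne (proj₁ (solutions w z′ (sound G 1F 0F (4 ↑ʳ_) (z′ ▹ w ▹ env) h)))))))
      where
      env = twos m ▹ z ▹ ρ

    disjunction : Formula VWSig 1
    disjunction = ⋁ (map (λ z → var 0F ≐ tm z) Z)

    oneOf : Term VWSig n → Formula VWSig n
    oneOf t = sub (t ▹ ε) disjunction

    -- Below a numeral bound `t` is itself a numeral, so `matrix` is decided: if true, `solutions`
    -- puts `t` into `Z`; if false, `M` is refuted.
    standard : ∀ j {i : Fin n} {t} → VW⁺ ⨾ Γ ⊢ sub (var i ▹ t ▹ tm ∘ ρ) ⌜ matrix ⌝ →
               VW⁺ ⨾ tm (twos j) ≐ var i ∷ Γ ⊢ oneOf t
    standard j {i} {t} M = ∣≤∣-elim (twos j)
      (leibniz (var 0F ∣≤∣ var 1F) {σ = t ▹ var i ▹ ε} {τ = t ▹ tm (twos j) ▹ ε}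
        (λ { 0F → ≐-refl _ ; 1F → ≐-sym hyp₀ }) (weaken₁ (∧-elim₁ (∧-elim₂ M))))
      (λ {u} → conclude {u})
      where
      conclude : ∀ {u} → u ⊴ twos j → VW⁺ ⨾ t ≐ tm u ∷ tm (twos j) ≐ var i ∷ _ ⊢ oneOf t
      conclude {u} _ with dec matrix (twos j ▹ u ▹ ρ)
      ... | yes (_ , _ , h , _) = ⋁-intro (λ z → var 0F ≐ tm z) (t ▹ ε)
        (proj₂ (solutions (twos j) u (sound G 0F 1F (2 ↑ʳ_) (twos j ▹ u ▹ ρ) h)))
        (conv (cong (t ≐_) (sym (subT-tm (t ▹ ε) u))) hyp₀)
      ... | no ¬h = ex-falso (⇒-elim (⊢false matrix ¬h)
        (leibniz ⌜ matrix ⌝ {σ = var i ▹ t ▹ tm ∘ ρ}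
          (λ { 0F → ≐-sym hyp₁ ; 1F → hyp₀ ; (suc (suc x)) → ≐-refl _ }) (weaken₁ (weaken₁ M))))

    -- By `climb` the bound is a standard power below `twos m`, or `twos m` is below it. In the
    -- latter case they are equal: otherwise `twos m`, which bounds the value `z₀`, contradicts
    -- minimality.
    ⊢oneOf : ∀ {z₀} → z₀ ∈ Z → ∀ {i : Fin n} {t} →
             VW⁺ ⨾ Γ ⊢ sub (var i ▹ t ▹ tm ∘ ρ) ⌜ matrix ⌝ → VW⁺ ⨾ Γ ⊢ oneOf t
    ⊢oneOf {z₀ = z₀} p {i} {t} M = climb m (∧-elim₁ M) (λ j _ → standard j M)
      (∨-elim (excluded-middle {φ = tm (twos m) ≐ var i}) (standard m (weaken₁ M))
        (ex-falso (⇒-elim (weaken₁ (weaken₁ (∧-elim₂ (∧-elim₂ (∧-elim₂ M)))))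
          (∃-intro (tm (twos m)) (∧-intro (∧-elim₂ hyp₁) (∧-intro (∧-elim₁ hyp₁) (∧-intro hyp₀
            (∃-intro (tm z₀) (∧-intro
              (conv (cong (tm z₀ ∣≤∣_) (sym (inst-renT-suc (tm z₀) (tm (twos m)))))
                (⊢⊴-twos m z₀ (short p)))
              (conv (sym instance-eq)
                (⊢true (formula G 0F 1F (2 ↑ʳ_)) {twos m ▹ z₀ ▹ ρ}
                  (complete G 0F 1F (2 ↑ʳ_) _ (holds p)))))))))))))
      where
      σ = var i ▹ t ▹ tm ∘ ρ
      ι = tm z₀ ▹ inst (tm (twos m))
      ξ : Fin (2 + k) → Fin (4 + k)
      ξ = 1F ▹ 0F ▹ (4 ↑ʳ_)
      τ : Fin (4 + k) → Term VWSig _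
      τ = subT ι ∘ liftS (liftS σ)
      param : ∀ x → τ (4 ↑ʳ x) ≡ tm (ρ x)
      param x = trans (cong (subT ι) (trans (cong (renT suc) (renT-tm suc (ρ x))) (renT-tm suc (ρ x))))
                      (subT-tm ι (ρ x))
      outer = ⌜ formula G 0F 1F (2 ↑ʳ_) ⌝
      inner = ⌜ formula G 1F 0F (4 ↑ʳ_) ⌝
      open ≡-Reasoning
      -- In the minimality clause `G` stands under two more quantifiers, with bound and value in
      -- exchanged positions; `natural` makes it a renaming of the outer occurrence.
      instance-eq : sub (inst (tm z₀)) (sub (liftS (inst (tm (twos m)))) (sub (liftS (liftS σ)) inner))
                  ≡ sub (tm ∘ (twos m ▹ z₀ ▹ ρ)) outer
      instance-eq = begin
        _                       ≡⟨ sub-inst-liftS (inst (tm (twos m))) (tm z₀) _ ⟩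
        sub ι (sub (liftS (liftS σ)) inner) ≡⟨ sub-sub ι (liftS (liftS σ)) inner ⟩
        sub τ inner             ≡⟨ cong (sub τ) (sym (natural G ξ 0F 1F (2 ↑ʳ_))) ⟩
        sub τ (ren ξ outer)     ≡⟨ sub-ren τ ξ outer ⟩
        sub (τ ∘ ξ) outer       ≡⟨ sub-cong (λ { 0F → refl ; 1F → refl ; (suc (suc x)) → param x }) outer ⟩
        _                       ∎

    first-elim : ∀ {z₀} → z₀ ∈ Z → ∀ {t : Term VWSig n} →
                 VW⁺ ⨾ Γ ⊢ sub (t ▹ tm ∘ ρ) first → VW⁺ ⨾ Γ ⊢ oneOf t
    first-elim p {t} d = ∃-elim (conv (cong (sub (t ▹ tm ∘ ρ)) first≡∃matrix) d)
      (conv wk-oneOf (⊢oneOf p {0F} {renT suc t}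
        (conv (sub-cong (λ { 0F → refl ; 1F → refl ; (suc (suc x)) → renT-tm suc (ρ x) }) ⌜ matrix ⌝)
          hyp₀)))
      where
      wk-oneOf : oneOf (renT suc t) ≡ wk (oneOf t)
      wk-oneOf = sym (trans (ren-sub suc (t ▹ ε) disjunction) (sub-cong (λ { 0F → refl }) disjunction))

-- Codes of trees

code : Tree → Word
code 𝟎         = nodeWord []
code ⟨ s , t ⟩ = nodeWord (code s ++ 𝟏 ∷ code t)

nodeWord-++ : ∀ u b → nodeWord u ++ b ≡ twos (length u) ++ 𝟏 ∷ (u ++ b)
nodeWord-++ u b = ++-assoc (twos (length u)) (𝟏 ∷ u) b

-- The 𝟐s before the first 𝟏 give the length of the content, and this length cuts the content out.
nodeWord-prefix : ∀ u v {a b} → nodeWord u ++ a ≡ nodeWord v ++ b → u ≡ v × a ≡ b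
nodeWord-prefix u v {a} {b} eq
  with twos-𝟏-injective (length u) (length v) (trans (sym (nodeWord-++ u a)) (trans eq (nodeWord-++ v b)))
... | l , eq′ with ++-injectiveˡ-length u v eq′ l
... | refl = refl , ++-cancelˡ u _ _ eq′

-- The arbitrary tails let induction apply to the left component, which the rest of the pair
-- follows. The content of 𝟎 is empty, that of a pair is not.
code-prefix : ∀ s t {a b} → code s ++ a ≡ code t ++ b → s ≡ t × a ≡ b
code-prefix 𝟎 𝟎 eq = refl , ∷-injectiveʳ eq
code-prefix 𝟎 ⟨ t , t′ ⟩ eq with nodeWord-prefix [] (code t ++ 𝟏 ∷ code t′) eq
... | p , _ with code t | p
... | []    | ()
... | _ ∷ _ | ()
code-prefix ⟨ s , s′ ⟩ 𝟎 eq with nodeWord-prefix (code s ++ 𝟏 ∷ code s′) [] eq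
... | p , _ with code s | p
... | []    | ()
... | _ ∷ _ | ()
code-prefix ⟨ s , s′ ⟩ ⟨ t , t′ ⟩ eq with nodeWord-prefix (code s ++ 𝟏 ∷ code s′) (code t ++ 𝟏 ∷ code t′) eq
... | p , q with code-prefix s t p
... | refl , p′ with code-prefix s′ t′ (cong (_++ []) (∷-injectiveʳ p′))
... | refl , _ = refl , q

code-injective : ∀ {s t} → code s ≡ code t → s ≡ t
code-injective {s} {t} eq = proj₁ (code-prefix s t (cong (_++ []) eq))

code-nodeWord : ∀ t → ∃ λ v → code t ≡ nodeWord v
code-nodeWord 𝟎         = [] , refl
code-nodeWord ⟨ _ , _ ⟩ = _ , refl

-- With a 𝟏 put before `y`, its first letter also becomes a place after a 𝟏.
begins-inside : ∀ a {u y} c → Begins u y → Begins (u ++ c) (a ++ 𝟏 ∷ y ++ c)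
begins-inside a {u} c (inj₁ refl) = inj₂ (≼-++ a)
begins-inside a {u} c (inj₂ p) with ≼⇒++ p
... | b , refl = inj₂ (≼-trans
  (subst (𝟏 ∷ u ++ c ≼_) (sym (cong (𝟏 ∷_) (++-assoc b (𝟏 ∷ u) c))) (there (≼-++ b))) (≼-++ a))

-- Both components of a pair stand right after a 𝟏: the left one after that of the header, the right
-- one after the separator.
code-begins : ∀ {s} t → s ∈ subterms t → ∃ λ b → Begins (code s ++ b) (code t)
code-begins 𝟎 (here refl) = [] , inj₁ refl
code-begins ⟨ t , t′ ⟩ (here refl) = [] , inj₁ (++-identityʳ _)
code-begins {s} ⟨ t , t′ ⟩ (there p) with ∈-++⁻ (subterms t) p
... | inj₁ q with code-begins t q
... | b , h = b ++ 𝟏 ∷ code t′ ,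
  subst (λ u → Begins u (code ⟨ t , t′ ⟩)) (++-assoc (code s) b _)
    (begins-inside (twos (length (code t ++ 𝟏 ∷ code t′))) (𝟏 ∷ code t′) h)
code-begins {s} ⟨ t , t′ ⟩ (there p) | inj₂ q with code-begins t′ q
... | b , h = b ++ [] ,
  subst (λ u → Begins u (code ⟨ t , t′ ⟩)) (++-assoc (code s) b _)
    (subst (Begins _)
      (trans (cong (λ y → (r ++ 𝟏 ∷ code t) ++ 𝟏 ∷ y) (++-identityʳ (code t′)))
        (++-assoc r (𝟏 ∷ code t) _))
      (begins-inside (r ++ 𝟏 ∷ code t) [] h))
  where r = twos (length (code t ++ 𝟏 ∷ code t′))

-- Formulated for arbitrary words, since the induction for the converse of `code-begins` meets
-- concatenations of several codes.
Located : (Tree → Set) → Word → Set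
Located Q y = ∀ v b → Begins (nodeWord v ++ b) y → ∃ λ s → Q s × nodeWord v ≡ code s

located-[] : ∀ {Q} → Located Q []
located-[] []      b (inj₁ ())
located-[] (_ ∷ _) b (inj₁ ())
located-[] v       b (inj₂ ())

-- The letters before the displayed 𝟏 are all 𝟐s, so no place after a 𝟏 lies among them.
begins-past : ∀ k {u y} → 𝟏 ∷ u ≼ twos k ++ 𝟏 ∷ y → Begins u y
begins-past zero    here      = inj₁ refl
begins-past zero    (there p) = inj₂ p
begins-past (suc k) (there p) = begins-past k p

nodeWord-++-prefix : ∀ u v {a b} → nodeWord u ++ a ≡ nodeWord v ++ b → nodeWord u ≡ nodeWord v
nodeWord-++-prefix u v eq = cong nodeWord (proj₁ (nodeWord-prefix u v eq))

-- The separator in a coded pair can itself be read, as the code of 𝟎. This is harmless because 𝟎 is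
-- a subterm of every tree.
located-𝟎 : ∀ {Q y} → Q 𝟎 → Located Q y → Located Q (𝟏 ∷ y)
located-𝟎 q h v b (inj₁ eq) = 𝟎 , q , nodeWord-++-prefix v [] eq
located-𝟎 q h v b (inj₂ p)  = h v b (begins-past 0 p)

-- Removing the header of a coded pair leaves the codes of its components with
-- that of 𝟎 between them.
located-code : ∀ {Q} t {y} → (∀ {s} → s ∈ subterms t → Q s) → Located Q y → Located Q (code t ++ y)
located-code 𝟎 q h = located-𝟎 (q (here refl)) h
located-code ⟨ s , t ⟩ {y} q h v b (inj₁ eq) =
  ⟨ s , t ⟩ , q (here refl) , nodeWord-++-prefix v (code s ++ 𝟏 ∷ code t) eq
located-code ⟨ s , t ⟩ {y} q h v b (inj₂ p) =
  located-code s (λ r → q (there (∈-++⁺ˡ r)))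
    (located-𝟎 (q (there (∈-++⁺ˡ (𝟎∈ s))))
      (located-code t (λ r → q (there (∈-++⁺ʳ (subterms s) r))) h))
    v b (subst (Begins _) (++-assoc (code s) (𝟏 ∷ code t) y)
      (begins-past (length (code s ++ 𝟏 ∷ code t))
        (subst (𝟏 ∷ nodeWord v ++ b ≼_) (nodeWord-++ (code s ++ 𝟏 ∷ code t) y) p)))
  where
  𝟎∈ : ∀ t → 𝟎 ∈ subterms t
  𝟎∈ 𝟎         = here refl
  𝟎∈ ⟨ s , _ ⟩ = there (∈-++⁺ˡ (𝟎∈ s))

-- Pairing and subterms at codes of trees

module _ (s t : Tree) where
  private
    ρ = code s ▹ code t ▹ ε
    z = code ⟨ s , t ⟩
    solutions : ∀ w z′ → Holds pairPredicate w z′ ρ → w ≡ twos (length z) × z′ ∈ z ∷ []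
    solutions w z′ (hw , hz) = trans hw (cong (twos ∘ length) hz) , here hz
    holds : ∀ {z′} → z′ ∈ z ∷ [] → Holds pairPredicate (twos (length z)) z′ ρ
    holds (here refl) = refl , refl
    short : ∀ {z′} → z′ ∈ z ∷ [] → length z′ ≤ length z
    short (here refl) = ≤-refl

  ⊢pair : VW⁺ ⨾ Γ ⊢ sub (tm (code ⟨ s , t ⟩) ▹ tm ∘ ρ) (first pairPredicate)
  ⊢pair = ⊢first pairPredicate {ρ} solutions holds short (here refl)

  pair-elim : ∀ {u : Term VWSig n} → VW⁺ ⨾ Γ ⊢ sub (u ▹ tm ∘ ρ) (first pairPredicate) →
              VW⁺ ⨾ Γ ⊢ u ≐ tm (code ⟨ s , t ⟩)
  pair-elim {u = u} d = conv (cong (u ≐_) (subT-tm (u ▹ ε) z))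
    (∨-elim (first-elim pairPredicate {ρ} solutions holds short (here refl) d) hyp₀ (ex-falso hyp₀))

module _ (t : Tree) where
  private
    ρ = code t ▹ ε
    Z = map code (subterms t)
    t∈ : ∀ t → t ∈ subterms t
    t∈ 𝟎         = here refl
    t∈ ⟨ _ , _ ⟩ = here refl
    solutions : ∀ w z → Holds subtermPredicate w z ρ → w ≡ twos (length (code t)) × z ∈ Z
    solutions w z (hw , (b , h) , (v , refl))
      with located-code {_∈ subterms t} t id located-[] v b
             (subst (Begins _) (sym (++-identityʳ (code t))) h)
    ... | s , p , eq = hw , subst (_∈ Z) (sym eq) (∈-map⁺ code p)
    holds : ∀ {z} → z ∈ Z → Holds subtermPredicate (twos (length (code t))) z ρ
    holds p with ∈-map⁻ code p
    ... | s , q , refl = refl , code-begins t q , code-nodeWord s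
    short : ∀ {z} → z ∈ Z → length z ≤ length (code t)
    short {z} p = let (_ , (_ , h) , _) = holds p in begins-length z h

  ⊢subterm : ∀ {s} → s ∈ subterms t → VW⁺ ⨾ Γ ⊢ sub (tm (code s) ▹ tm ∘ ρ) (first subtermPredicate)
  ⊢subterm p = ⊢first subtermPredicate {ρ} solutions holds short (∈-map⁺ code p)

  subterm-elim : ∀ {u : Term VWSig n} → VW⁺ ⨾ Γ ⊢ sub (u ▹ tm ∘ ρ) (first subtermPredicate) →
                 (∀ {s} → s ∈ subterms t → VW⁺ ⨾ u ≐ tm (code s) ∷ Γ ⊢ φ) → VW⁺ ⨾ Γ ⊢ φ
  subterm-elim {φ = φ} {u = u} d c =
    ⋁-elim (λ z → var 0F ≐ tm z) (u ▹ ε) Z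
      (first-elim subtermPredicate {ρ} solutions holds short (∈-map⁺ code (t∈ t)) d) go
    where
    go : ∀ {z} → z ∈ Z → VW⁺ ⨾ u ≐ subT (u ▹ ε) (tm z) ∷ _ ⊢ φ
    go {z} p with ∈-map⁻ code p
    ... | s , q , refl = subst (λ v → VW⁺ ⨾ u ≐ v ∷ _ ⊢ φ) (sym (subT-tm (u ▹ ε) (code s))) (c q)

-- Totalization

isUnique : Formula VWSig (suc n) → Formula VWSig (suc n)
isUnique A = A ∧ ∀′ (ren (lift {VWSig} suc) A ⇒ var 0F ≐ var 1F)

totalize : Formula VWSig (suc n) → Formula VWSig (suc n)
totalize A = isUnique A ∨ ¬ wk (∃! A) ∧ var 0F ≐ e

lift-inst : (φ : Formula VWSig (suc n)) → ren (lift {VWSig} suc) φ [ var 0F ] ≡ φ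
lift-inst φ = trans (sub-ren (inst (var 0F)) (lift {VWSig} suc) φ)
  (trans (sub-cong (λ { zero → refl ; (suc i) → refl }) φ) (sub-var φ))

sub-lift-suc : (s t : Term VWSig n) (σ : Fin m → Term VWSig n) (A : Formula VWSig (suc m)) →
               sub (t ▹ s ▹ σ) (ren (lift {VWSig} suc) A) ≡ sub (t ▹ σ) A
sub-lift-suc s t σ A = trans (sub-ren (t ▹ s ▹ σ) (lift {VWSig} suc) A)
  (sub-cong (λ { zero → refl ; (suc i) → refl }) A)

module _ (A : Formula VWSig (suc m)) (σ : Fin m → Term VWSig n) where

  totalize-intro : ∀ {s} → VW⁺ ⨾ Γ ⊢ sub (s ▹ σ) A →
                   VW⁺ ⨾ sub (var 0F ▹ renT suc ∘ σ) A ∷ map wk Γ ⊢ var 0F ≐ renT suc s →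
                   VW⁺ ⨾ Γ ⊢ sub (s ▹ σ) (totalize A)
  totalize-intro {Γ = Γ} {s = s} d e = ∨-intro₁ (∧-intro d (∀-intro (⇒-intro
    (subst (λ φ → VW⁺ ⨾ φ ∷ map wk Γ ⊢ var 0F ≐ renT suc s)
      (sym (trans (sub-ren (liftS (s ▹ σ)) (lift {VWSig} suc) A)
             (sub-cong (λ { zero → refl ; (suc i) → refl }) A))) e))))

  isUnique-elim : ∀ {s t} → VW⁺ ⨾ Γ ⊢ sub (s ▹ σ) (isUnique A) → VW⁺ ⨾ Γ ⊢ sub (t ▹ σ) A →
                  VW⁺ ⨾ Γ ⊢ t ≐ s
  isUnique-elim {s = s} {t} d e =
    conv (cong (t ≐_) (inst-renT-suc t s))
      (⇒-elim (∀-elim (∧-elim₂ d) t)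
        (conv (sym (trans (sub-inst-liftS (s ▹ σ) t (ren (lift {VWSig} suc) A)) (sub-lift-suc s t σ A))) e))

  sub-wk-∃! : ∀ t → sub (t ▹ σ) (wk (∃! A)) ≡ sub σ (∃! A)
  sub-wk-∃! t = sub-ren (t ▹ σ) suc (∃! A)

  isUnique⇒∃! : ∀ {s} → VW⁺ ⨾ Γ ⊢ sub (s ▹ σ) (isUnique A) → VW⁺ ⨾ Γ ⊢ sub σ (∃! A)
  isUnique⇒∃! {s = s} d = ∃-intro s (conv (sym (sub-inst-liftS σ s (isUnique A))) d)

  -- In the mixed cases one side denies the unique existence that the other provides.
  totalize-unique : ∀ {s t} → VW⁺ ⨾ Γ ⊢ sub (s ▹ σ) (totalize A) →
                    VW⁺ ⨾ Γ ⊢ sub (t ▹ σ) (totalize A) → VW⁺ ⨾ Γ ⊢ s ≐ t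
  totalize-unique {s = s} {t} d e = ∨-elim d
    (∨-elim (weaken₁ e) (isUnique-elim hyp₀ (∧-elim₁ hyp₁))
      (ex-falso (⇒-elim (conv (cong ¬_ (sub-wk-∃! t)) (∧-elim₁ hyp₀)) (isUnique⇒∃! {s = s} hyp₁))))
    (∨-elim (weaken₁ e)
      (ex-falso (⇒-elim (conv (cong ¬_ (sub-wk-∃! s)) (∧-elim₁ hyp₁)) (isUnique⇒∃! {s = t} hyp₀)))
      (≐-trans (∧-elim₂ hyp₁) (≐-sym (∧-elim₂ hyp₀))))

  totalize-exists : VW⁺ ⨾ Γ ⊢ sub σ (∃′ (totalize A))
  totalize-exists = ∨-elim (excluded-middle {φ = sub σ (∃! A)})
    (∃-elim hyp₀ (∃-intro (var 0F)
      (conv (sym (lift-inst (sub (liftS σ) (totalize A)))) (∨-intro₁ hyp₀))))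
    (∃-intro e (conv (sym (sub-inst-liftS σ e (totalize A)))
      (∨-intro₂ (∧-intro (conv (cong ¬_ (sym (sub-wk-∃! e))) hyp₀) (≐-refl e)))))

-- The interpretation

interpretation : Translation WTSig VWSig
interpretation = record
  { dom  = ⊤
  ; funτ = λ t → var 0F ≐ tm (code t)
  -- The value is variable 0 in `first` but the last argument of `T`. For `⊑-rel` the subterm, as
  -- the value, already comes first.
  ; relτ = λ { T-rel → ren (2F ▹ 0F ▹ 1F ▹ ε) (totalize (first pairPredicate))
             ; ⊑-rel → first subtermPredicate }
  }

open Translation interpretation

-- Every term has a term as its value, so the quantifiers of `atValues` reduce to a substitution.
trT : Term WTSig n → Term VWSig n
trT (var x)    = var x
trT (fun t []) = tm (code t)

values-intro : (ts : Vec (Term WTSig n) k) {ρ : Fin n → Fin m} {ys : Fin k → Fin m}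
               {l : ℕ} {Γ : List (Formula VWSig l)} (σ : Fin m → Term VWSig l) →
               (∀ i → σ (ys i) ≡ subT σ (renT ρ (trT (lookup ts i)))) → VW⁺ ⨾ Γ ⊢ sub σ (values ts ρ ys)
values-intro []       σ eqs = ⊤-intro
values-intro (t ∷ ts) {ρ} {ys} {Γ = Γ} σ eqs =
  ∧-intro (∧-intro ⊤-intro (at t (eqs 0F))) (values-intro ts σ (eqs ∘ suc))
  where
  at : ∀ t → σ (ys 0F) ≡ subT σ (renT ρ (trT t)) → VW⁺ ⨾ Γ ⊢ sub σ (value t ρ (ys 0F))
  at (var x)    eq = conv (cong (σ (ys 0F) ≐_) eq) (≐-refl _)
  at (fun t []) eq = ∧-intro ⊤-intro (conv (cong (σ (ys 0F) ≐_)
    (trans eq (cong (subT σ) (trans (renT-tm ρ (code t)) (sym (renT-tm _ (code t))))))) (≐-refl _))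

values-elim : (ts : Vec (Term WTSig n) k) {ρ : Fin n → Fin m} {ys : Fin k → Fin m}
              {Γ : List (Formula VWSig m)} →
              VW⁺ ⨾ Γ ⊢ values ts ρ ys → ∀ i → VW⁺ ⨾ Γ ⊢ var (ys i) ≐ renT ρ (trT (lookup ts i))
values-elim (var x ∷ ts) d zero = ∧-elim₂ (∧-elim₁ d)
values-elim (fun t [] ∷ ts) {ρ} {ys} d zero =
  conv (cong (var (ys 0F) ≐_) (trans (renT-tm _ (code t)) (sym (renT-tm ρ (code t)))))
    (∧-elim₂ (∧-elim₂ (∧-elim₁ d)))
values-elim (_ ∷ ts) d (suc i) = values-elim ts (∧-elim₂ d) i

atValues-intro : (ts : Vec (Term WTSig n) k) (θ : Formula VWSig k) →
                 VW⁺ ⨾ Γ ⊢ sub (trT ∘ lookup ts) θ → VW⁺ ⨾ Γ ⊢ atValues ts θ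
atValues-intro {k = k} ts θ d = ∃^-intro k (trT ∘ lookup ts) (∧-intro
  (values-intro ts (prepend k (trT ∘ lookup ts) var)
    (λ i → trans (prepend-↑ˡ k (trT ∘ lookup ts) var i)
             (sym (subT-prepend-↑ʳ k (trT ∘ lookup ts) (trT (lookup ts i))))))
  (conv (sym (sub-prepend-↑ˡ k (trT ∘ lookup ts) θ)) d))

atValues-elim : (ts : Vec (Term WTSig n) k) (θ : Formula VWSig k) →
                VW⁺ ⨾ Γ ⊢ atValues ts θ → VW⁺ ⨾ Γ ⊢ sub (trT ∘ lookup ts) θ
atValues-elim {k = k} ts θ d = cut d (weaken (∷⁺ʳ _ λ ()) (∃^-elim k
  (conv (sym (ren-sub (k ↑ʳ_) (trT ∘ lookup ts) θ))
    (leibniz θ (values-elim ts (∧-elim₁ hyp₀)) (conv (ren≡sub (_↑ˡ _) θ) (∧-elim₂ hyp₀))))))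

translate-⋁ : ∀ {X : Set} (g : X → Formula WTSig n) xs →
              translate (⋁ (map g xs)) ≡ sub var (⋁ (map (translate ∘ g) xs))
translate-⋁ g []       = refl
translate-⋁ g (x ∷ xs) = cong₂ _∨_ (sym (sub-var _)) (translate-⋁ g xs)

pair-args : (σ : Fin 3 → Term VWSig n) {τ : Fin 2 → Term VWSig n} → σ 0F ≡ τ 0F → σ 1F ≡ τ 1F →
            sub σ (relτ T-rel) ≡ sub (σ 2F ▹ τ) (totalize (first pairPredicate))
pair-args σ p q = trans (sub-ren σ (2F ▹ 0F ▹ 1F ▹ ε) (totalize (first pairPredicate)))
  (sub-cong (λ { 0F → refl ; 1F → p ; 2F → q }) (totalize (first pairPredicate)))

-- The translated axioms

open WTSyntax using () renaming (_̲ to _̲ᵀ)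

⊢axioms : ∀ {φ} → WTRel φ → VW⁺ ⊢ translate φ
⊢axioms (WT1 {s} {t} s≢t) = ⇒-intro (⇒-elim (⊢tm-≢ (code s) (code t) (s≢t ∘ code-injective))
  (atValues-elim (s ̲ᵀ ∷ t ̲ᵀ ∷ []) (var 0F ≐ var 1F) hyp₀))
⊢axioms (WT2 t) = ∀-intro (⇒-intro (∧-intro
  (⇒-intro (conv (sym (translate-⋁ g (subterms t)))
    (subterm-elim t {u = var 0F}
      (conv (sub-cong (λ { 0F → refl ; 1F → refl }) (first subtermPredicate))
        (atValues-elim (var 0F ∷ t ̲ᵀ ∷ []) (first subtermPredicate) hyp₀))
      (λ {s} p → ⋁-intro (translate ∘ g) var p (conv (sym (sub-var _))
        (atValues-intro (var 0F ∷ s ̲ᵀ ∷ []) (var 0F ≐ var 1F) hyp₀))))))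
  (⇒-intro (⋁-elim (translate ∘ g) var (subterms t) (conv (translate-⋁ g (subterms t)) hyp₀)
    (λ {s} p → cut (conv (sub-var _) hyp₀)
      (atValues-intro (var 0F ∷ t ̲ᵀ ∷ []) (first subtermPredicate)
        (leibniz (first subtermPredicate) {σ = tm (code s) ▹ tm ∘ (code t ▹ ε)}
          (λ { 0F → ≐-sym (atValues-elim (var 0F ∷ s ̲ᵀ ∷ []) (var 0F ≐ var 1F) hyp₀) ; 1F → ≐-refl _ })
          (⊢subterm t p))))))))
  where
  g : Tree → Formula WTSig 1
  g s = var 0F ≐ s ̲ᵀ
⊢axioms (WT3 s t) = atValues-intro ts (relτ T-rel)
  (conv (sym (pair-args (trT ∘ lookup ts) {tm ∘ ρ} refl refl))
    -- By `pair-elim` no other element is a value, so the first disjunct of `totalize` applies.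
    (totalize-intro (first pairPredicate) (tm ∘ ρ) (⊢pair s t)
      (conv (cong (var 0F ≐_) (sym (renT-tm suc (code ⟨ s , t ⟩))))
        (pair-elim s t (conv
          (sub-cong (λ { 0F → refl ; 1F → renT-tm suc (code s) ; 2F → renT-tm suc (code t) })
            (first pairPredicate))
          hyp₀)))))
  where
  ts = s ̲ᵀ ∷ t ̲ᵀ ∷ ⟨ s , t ⟩ ̲ᵀ ∷ []
  ρ = code s ▹ code t ▹ ε
⊢axioms WT4 = ∀-intro (⇒-intro (∀-intro (⇒-intro
  (∃-elim (totalize-exists (first pairPredicate) (var 1F ▹ var 0F ▹ ε))
    (∃-intro (var 0F) (conv (sym (lift-inst (⊤ ∧ atValues ts (relτ T-rel))))
      (∧-intro ⊤-intro (atValues-intro ts (relτ T-rel)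
        (conv (sym (trans (pair-args (trT ∘ lookup ts) {var 2F ▹ var 1F ▹ ε} refl refl)
                     (sub-cong (λ { 0F → refl ; 1F → refl ; 2F → refl })
                       (totalize (first pairPredicate))))) hyp₀)))))))))
  where
  ts : Vec (Term WTSig 3) 3
  ts = var 2F ∷ var 1F ∷ var 0F ∷ []
⊢axioms WT5 = ∀-intro (⇒-intro (∀-intro (⇒-intro (∀-intro (⇒-intro (∀-intro (⇒-intro (⇒-intro
  (atValues-intro (var 1F ∷ var 0F ∷ []) (var 0F ≐ var 1F)
    (totalize-unique (first pairPredicate) (var 3F ▹ var 2F ▹ ε)
      (at 1F (∧-elim₁ hyp₀)) (at 0F (∧-elim₂ hyp₀))))))))))))
  where
  at : ∀ {Γ : List (Formula VWSig 4)} (i : Fin 4) →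
       VW⁺ ⨾ Γ ⊢ atValues (var 3F ∷ var 2F ∷ var i ∷ []) (relτ T-rel) →
       VW⁺ ⨾ Γ ⊢ sub (var i ▹ var 3F ▹ var 2F ▹ ε) (totalize (first pairPredicate))
  at i d = conv (pair-args (trT ∘ lookup (var 3F ∷ var 2F ∷ var i ∷ [])) {var 3F ▹ var 2F ▹ ε} refl refl)
    (atValues-elim (var 3F ∷ var 2F ∷ var i ∷ []) (relτ T-rel) d)

⊢functional : ∀ t → VW⁺ ⊢ functional t
⊢functional t = ⇒-intro (∃-intro (tm (code t)) (∧-intro
  (∧-intro ⊤-intro (conv (cong (tm (code t) ≐_) (sym (subT-tm _ (code t)))) (≐-refl _)))
  (∀-intro (⇒-intro (conv (cong (var 0F ≐_)
    (trans (cong (subT _) (renT-tm _ (code t)))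
      (trans (subT-tm _ (code t)) (sym (renT-tm suc (code t)))))) (∧-elim₂ hyp₀))))))

theorem3p7 : WTRel IsInterpretableIn VW⁺
theorem3p7 = interpretation , record
  { dom-inhabited = ∃-intro e ⊤-intro
  ; fun-total     = ⊢functional
  ; axioms        = ⊢axioms
  }
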